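{- Let $K\ge2$ and $n\ge K^2+K-1$ be integers. Then the number $N^{\sim_{3/2}}_K(n)$ of $\sim_{3/2}$-classes in $\{\mathtt a,\mathtt b\}^n$ of cardinality $K$ is $$N^{\sim_{3/2}}_K(n)=\sum_{r=2}^{K}\bigl(\#\{\alpha\in\mathbb N:L_r(\alpha)=K\}+\#\{\beta\in\mathbb N_{>0}:R_r(\beta)=K\}\bigr).$$
   Context: $\mathbb N=\{0,1,2,\dots\}$ and $\mathbb N_{>0}=\mathbb N\setminus\{0\}$. For a word $w$ over $\{\mathtt a,\mathtt b\}$, $|w|_{\mathtt a}$ is the number of letters $\mathtt a$ and $\binom{w}{\mathtt{ab}}$ the number of occurrences of $\mathtt{ab}$ as a scattered subword. Set $\operatorname{strip}(w)=\lfloor\binom{w}{\mathtt{ab}}/|w|_{\mathtt a}\rfloor$ if $|w|_{\mathtt a}>0$, and $0$ if $|w|_{\mathtt a}=0$. For $u,w\in\{\mathtt a,\mathtt b\}^n$, $u\sim_{3/2}w$ iff $|u|_{\mathtt a}=|w|_{\mathtt a}$ and $\operatorname{strip}(u)=\operatorname{strip}(w)$. Let $p_{\le r}(\xi)$ be the number of partitions of $\xi$ with at most $r$ parts. For $r\ge2$, $\alpha\in\mathbb N$, $\beta\in\mathbb N_{>0}$ define $$L_r(\alpha)=\sum_{\xi=\alpha r}^{(\alpha+1)r-1}p_{\le r}(\xi),\qquad R_r(\beta)=\sum_{\xi=(\beta-1)r+1}^{\beta r}p_{\le r}(\xi).$$ -}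

module Defs where

open import Data.Fin.Base as Fin using (Fin)
import Data.Fin.Properties as Fin
open import Data.List.Base
  using (List; []; _∷_; length; map; filter; concatMap; cartesianProduct;
         cartesianProductWith; allFin; upTo; applyUpTo)
open import Data.List.Relation.Unary.All using (All; all?)
open import Data.List.Relation.Unary.Linked using (Linked; linked?)
open import Data.Nat.Base
  using (ℕ; zero; suc; _+_; _*_; _∸_; _/_; _≤_; _<_; _≥_)
open import Data.Nat.ListAction using (sum)
open import Data.Nat.Properties using (_≟_; _<?_; _≥?_)
open import Data.Product.Base using (Σ; _×_; _,_; proj₁)
open import Data.Vec.Base using (Vec; lookup; count)
open import Function.Bundles using (Inverse)
open import Level using (Level; _⊔_; 0ℓ)
open import Relation.Binary.Bundles using (Setoid)
import Relation.Binary.Construct.On as On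
open import Relation.Binary.Definitions using (DecidableEquality)
open import Relation.Binary.PropositionalEquality as ≡ using (_≡_; refl)
open import Relation.Nullary.Decidable using (Dec; yes; no; _×-dec_)

private
  variable
    a ℓ p : Level
    A : Set a

_hasCardinality_ : Setoid a ℓ → ℕ → Set (a ⊔ ℓ)
S hasCardinality k = Inverse S (≡.setoid (Fin k))

-- Elements are compared in S only, so membership proofs do not affect
-- cardinality.
subsetoid : (S : Setoid a ℓ) → (Setoid.Carrier S → Set p) → Setoid (a ⊔ p) ℓ
subsetoid S P = On.setoid S (proj₁ {B = P})

setOf : {A : Set a} → (A → Set p) → Setoid (a ⊔ p) a
setOf {A = A} = subsetoid (≡.setoid A)

-- Both bounds are included; the sum is empty when hi < lo.
sumFromTo : ℕ → ℕ → (ℕ → ℕ) → ℕ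
sumFromTo lo hi f = sum (map f (applyUpTo (lo +_) (suc hi ∸ lo)))

infix 6 sumFromTo
syntax sumFromTo lo hi (λ i → e) = ∑[ i ∈ lo ⋯ hi ] e

data Letter : Set where
  𝚊 𝚋 : Letter

_≟ᴸ_ : DecidableEquality Letter
𝚊 ≟ᴸ 𝚊 = yes refl
𝚊 ≟ᴸ 𝚋 = no λ ()
𝚋 ≟ᴸ 𝚊 = no λ ()
𝚋 ≟ᴸ 𝚋 = yes refl

Word : ℕ → Set
Word = Vec Letter

private
  variable
    n : ℕ

∣_∣ₐ : Word n → ℕ
∣ w ∣ₐ = count (𝚊 ≟ᴸ_) w

OccursAt : Word n → Fin n × Fin n → Set
OccursAt w (i , j) = i Fin.< j × lookup w i ≡ 𝚊 × lookup w j ≡ 𝚋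

occursAt? : (w : Word n) → ∀ ij → Dec (OccursAt w ij)
occursAt? w (i , j) =
  (i Fin.<? j) ×-dec (lookup w i ≟ᴸ 𝚊) ×-dec (lookup w j ≟ᴸ 𝚋)

binom-ab : Word n → ℕ
binom-ab {n} w =
  length (filter (occursAt? w) (cartesianProduct (allFin n) (allFin n)))

floorDiv : ℕ → ℕ → ℕ
floorDiv m zero      = 0
floorDiv m d@(suc _) = m / d

strip : Word n → ℕ
strip w = floorDiv (binom-ab w) ∣ w ∣ₐ

infix 4 _∼_
_∼_ : Word n → Word n → Set
u ∼ w = ∣ u ∣ₐ ≡ ∣ w ∣ₐ × strip u ≡ strip w

wordSetoid : ℕ → Setoid 0ℓ 0ℓ
wordSetoid n = record
  { Carrier       = Word n
  ; _≈_           = _∼_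
  ; isEquivalence = record
    { refl  = refl , refl
    ; sym   = λ (p , q) → ≡.sym p , ≡.sym q
    ; trans = λ (p , q) (p′ , q′) → ≡.trans p p′ , ≡.trans q q′
    }
  }

class : Word n → Setoid 0ℓ 0ℓ
class w = setOf (λ u → u ∼ w)

-- The elements are words, but equality is _∼_: up to that equality there is
-- exactly one element for each class with K words.
classesOfSize : ℕ → ℕ → Setoid 0ℓ 0ℓ
classesOfSize K n = subsetoid (wordSetoid n) (λ w → class w hasCardinality K)

IsPartition : ℕ → List ℕ → Set
IsPartition ξ ps = All (0 <_) ps × Linked _≥_ ps × sum ps ≡ ξ

isPartition? : ∀ ξ ps → Dec (IsPartition ξ ps)
isPartition? ξ ps = all? (0 <?_) ps ×-dec linked? _≥?_ ps ×-dec (sum ps ≟ ξ)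

tuples : ℕ → List A → List (List A)
tuples zero    xs = [] ∷ []
tuples (suc k) xs = cartesianProductWith _∷_ xs (tuples k xs)

-- The search is exhaustive because the parts of a partition of ξ are at most ξ.
partitions≤ : ℕ → ℕ → List (List ℕ)
partitions≤ r ξ =
  filter (isPartition? ξ)
         (concatMap (λ k → tuples k (upTo (suc ξ))) (upTo (suc r)))

p≤ : ℕ → ℕ → ℕ
p≤ r ξ = length (partitions≤ r ξ)

L : ℕ → ℕ → ℕ
L r α = ∑[ ξ ∈ α * r ⋯ (α + 1) * r ∸ 1 ] p≤ r ξ

R : ℕ → ℕ → ℕ
R r β = ∑[ ξ ∈ (β ∸ 1) * r + 1 ⋯ β * r ] p≤ r ξ

{-# OPTIONS --safe #-}

-- Words with r letters a and s letters b correspond to partitions inside an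
-- r × s box, binom-ab being the size of the partition; a class with strip t
-- collects the r consecutive sizes tr, …, tr + r − 1. If this window lies
-- within the first s sizes, the bound on the parts is vacuous and the class
-- has L_r(t) words; if it lies within the last s sizes, complementation in the
-- box gives R_r(s − t). In between, every size is attained by more than K/2
-- partitions, so a class there has more than K words. Finally, L_r(α) = K and
-- R_r(β) = K force r(α + 1) ≤ K and rβ ≤ K, so for n ≥ K² + K − 1 all these
-- solutions occur, and the two ends of the box do not meet.

module Submission where

open import Defs
open import Data.Nat.Base using (ℕ; _+_; _∸_; _^_; _≤_; _<_; _≥_)
open import Data.Product.Base using (_×_; Σ-syntax)
open import Relation.Binary.PropositionalEquality using (_≡_)

open import Data.Fin.Base using (Fin; zero; suc)
open import Data.Fin.Permutation using (↔⇒≡)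
import Data.Fin.Properties as Fin
open import Data.List.Base
  using (List; []; _∷_; _++_; length; map; filter; concatMap; cartesianProduct;
         allFin; upTo; applyUpTo; applyDownFrom; reverse; lookup)
open import Data.List.Membership.Propositional using (_∈_; lose; find)
open import Data.List.Membership.Propositional.Properties
open import Data.List.Membership.Propositional.Properties.WithK using (unique∧set⇒bag)
open import Data.List.Properties
  using (length-++; length-map; map-applyUpTo; map-cong; map-∘; map-id-local;
         reverse-applyUpTo; ∷-injective)
open import Data.List.Relation.Binary.BagAndSetEquality using (∼bag⇒↭)
open import Data.List.Relation.Binary.Permutation.Propositional.Properties
  using (↭-length; ↭-reverse)
open import Data.List.Relation.Unary.All as All using (All; []; _∷_)
open import Data.List.Relation.Unary.AllPairs using ([]; _∷_)
open import Data.List.Relation.Unary.Any using (here; there; index)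
open import Data.List.Relation.Unary.Any.Properties using (lookup-index)
open import Data.List.Relation.Unary.Linked as Linked using (Linked; []; [-]; _∷_)
open import Data.List.Relation.Unary.Linked.Properties using (Linked⇒All)
open import Data.List.Relation.Unary.Unique.Propositional using (Unique)
import Data.List.Relation.Unary.Unique.Propositional.Properties as Unique
open import Data.Nat.Base using (zero; suc; _*_; _/_; _%_; z≤n; s≤s; z<s; s<s)
open import Data.Nat.Divisibility using (n∣m*n)
open import Data.Nat.DivMod
  using (+-distrib-/-∣ˡ; m*n/n≡m; m<n⇒m/n≡0; m≡m%n+[m/n]*n; m%n<n)
open import Data.Nat.ListAction using (sum)
open import Data.Nat.ListAction.Properties using (sum-↭)
open import Data.Nat.Properties
open import Data.Nat.Tactic.RingSolver using (solve-∀)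
open import Data.Product.Base as Product using (∃; _,_; proj₁; proj₂)
open import Data.Product.Properties using (,-injective; ,-injectiveʳ)
open import Data.Sum.Base using (_⊎_; inj₁; inj₂)
open import Data.Vec.Base as Vec using ([]; _∷_)
import Data.Vec.Properties as Vec
open import Function.Base using (_∘_; id; flip)
open import Function.Bundles using (mk⇔)
import Function.Construct.Composition as Composition
import Function.Construct.Symmetry as Symmetry
open import Level using (Level)
open import Relation.Binary.Bundles using (Setoid)
open import Relation.Binary.PropositionalEquality
  using (_≢_; refl; sym; trans; cong; cong₂; subst; subst₂; module ≡-Reasoning)
open import Relation.Nullary using (¬_; yes; no; contradiction)

-- The middle of the box does not call for unimodality of the Gaussian coefficients, which is hard
-- to prove; a crude bound suffices. In two rows the coefficients are explicit and symmetric: ⌊ξ/2⌋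
-- + 1 for ξ ≤ s. A further row preserves the bound k + 1 on the range 2k ≤ ξ ≤ rs - 2k, because
-- that row may be left empty or filled completely, and for 4k ≤ s these two injections reach every
-- size of the longer range. The constant K² + K - 1 arises in two stages. Below strip s every size
-- in the window is attained, so a class of K words has r ≤ K. This leaves s ≥ n - K ≥ K² - 1, and
-- 2K ≤ K² then makes the box wide enough for both ends.

private variable
  a b ℓ p : Level
  A : Set a
  B : Set b
  n : ℕ

-- Partitions in a box

-- With `z = 0` this is multiplication of a generating function by q^k. The default value is a
-- parameter so that the same operation also acts on enumerations, with `z = []`, and `shift-map`
-- passes from lists to their lengths.
shift : A → ℕ → (ℕ → A) → ℕ → A
shift z zero    f ξ       = f ξ
shift z (suc k) f zero    = z
shift z (suc k) f (suc ξ) = shift z k f ξ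

shift-elim : ∀ {z : A} {f : ℕ → A} (Q : A → Set b) k ξ → (ξ < k → Q z) →
             (∀ η → ξ ≡ k + η → Q (f η)) → Q (shift z k f ξ)
shift-elim Q zero    ξ       _    hit = hit ξ refl
shift-elim Q (suc k) zero    miss _   = miss z<s
shift-elim Q (suc k) (suc ξ) miss hit =
  shift-elim Q k ξ (miss ∘ s<s) (λ η → hit η ∘ cong suc)

shift-hit : ∀ (z : A) k f η → shift z k f (k + η) ≡ f η
shift-hit z zero    f η = refl
shift-hit z (suc k) f η = shift-hit z k f η

shift-map : ∀ (g : A → B) z k f ξ → g (shift z k f ξ) ≡ shift (g z) k (g ∘ f) ξ
shift-map g z zero    f ξ       = refl
shift-map g z (suc k) f zero    = refl
shift-map g z (suc k) f (suc ξ) = shift-map g z k f ξ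

shift-cong : ∀ (z : A) k {f g : ℕ → A} → (∀ η → f η ≡ g η) →
             ∀ ξ → shift z k f ξ ≡ shift z k g ξ
shift-cong z zero    f≗g ξ       = f≗g ξ
shift-cong z (suc k) f≗g zero    = refl
shift-cong z (suc k) f≗g (suc ξ) = shift-cong z k f≗g ξ

shift-shift : ∀ (z : A) k l f ξ → shift z k (shift z l f) ξ ≡ shift z (k + l) f ξ
shift-shift z zero    l f ξ       = refl
shift-shift z (suc k) l f zero    = refl
shift-shift z (suc k) l f (suc ξ) = shift-shift z k l f ξ

shift-distrib-+ : ∀ k f g ξ →
  shift 0 k (λ η → f η + g η) ξ ≡ shift 0 k f ξ + shift 0 k g ξ
shift-distrib-+ zero    f g ξ       = refl
shift-distrib-+ (suc k) f g zero    = refl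
shift-distrib-+ (suc k) f g (suc ξ) = shift-distrib-+ k f g ξ

δ : ℕ → ℕ
δ zero    = 1
δ (suc _) = 0

-- The coefficient of q^ξ in the Gaussian binomial [r+s choose r]: the number
-- of partitions of ξ with at most r parts, all at most s.
boxed : ℕ → ℕ → ℕ → ℕ
boxed zero    s       ξ = δ ξ
boxed (suc r) zero    ξ = boxed r zero ξ
boxed (suc r) (suc s) ξ = shift 0 (suc s) (boxed r (suc s)) ξ + boxed (suc r) s ξ

-- Removing a full column instead of a full row.
boxed-dual : ∀ r s ξ →
  boxed (suc r) (suc s) ξ ≡ boxed r (suc s) ξ + shift 0 (suc r) (boxed (suc r) s) ξ
boxed-dual zero zero ξ = +-comm (shift 0 1 δ ξ) (δ ξ)
boxed-dual zero (suc s) ξ = begin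
  shift 0 (2 + s) δ ξ + boxed 1 (suc s) ξ
    ≡⟨ cong₂ _+_ (sym (shift-shift 0 1 (suc s) δ ξ)) (boxed-dual zero s ξ) ⟩
  shift 0 1 (shift 0 (suc s) δ) ξ + (δ ξ + shift 0 1 (boxed 1 s) ξ)
    ≡⟨ rearrange (shift 0 1 (shift 0 (suc s) δ) ξ) (δ ξ) _ ⟩
  δ ξ + (shift 0 1 (shift 0 (suc s) δ) ξ + shift 0 1 (boxed 1 s) ξ)
    ≡⟨ cong (δ ξ +_) (shift-distrib-+ 1 (shift 0 (suc s) δ) (boxed 1 s) ξ) ⟨
  δ ξ + shift 0 1 (boxed 1 (suc s)) ξ ∎
  where
  open ≡-Reasoning
  rearrange : ∀ x y z → x + (y + z) ≡ y + (x + z)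
  rearrange = solve-∀
boxed-dual (suc r) zero ξ = begin
  shift 0 1 (boxed (suc r) 1) ξ + b₀
    ≡⟨ cong (_+ b₀) (shift-cong 0 1 (boxed-dual r zero) ξ) ⟩
  shift 0 1 (λ η → boxed r 1 η + shift 0 (suc r) (boxed (suc r) 0) η) ξ + b₀
    ≡⟨ cong (_+ b₀) (shift-distrib-+ 1 (boxed r 1) (shift 0 (suc r) (boxed (suc r) 0)) ξ) ⟩
  shift 0 1 (boxed r 1) ξ + shift 0 1 (shift 0 (suc r) (boxed (suc r) 0)) ξ + b₀
    ≡⟨ cong (λ x → shift 0 1 (boxed r 1) ξ + x + b₀) (shift-shift 0 1 (suc r) (boxed r 0) ξ) ⟩
  shift 0 1 (boxed r 1) ξ + shift 0 (2 + r) (boxed r 0) ξ + b₀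
    ≡⟨ rearrange (shift 0 1 (boxed r 1) ξ) _ b₀ ⟩
  boxed (suc r) 1 ξ + shift 0 (2 + r) (boxed (2 + r) 0) ξ ∎
  where
  open ≡-Reasoning
  b₀ = boxed r 0 ξ
  rearrange : ∀ x y z → x + y + z ≡ x + z + y
  rearrange = solve-∀
boxed-dual (suc r) (suc s) ξ = begin
  shift 0 (2 + s) (boxed (suc r) (2 + s)) ξ + boxed (2 + r) (suc s) ξ
    ≡⟨ cong₂ _+_ (shift-cong 0 (2 + s) (boxed-dual r (suc s)) ξ) (boxed-dual (suc r) s ξ) ⟩
  shift 0 (2 + s) (λ η → boxed r (2 + s) η + shift 0 (suc r) (boxed (suc r) (suc s)) η) ξ + (x + y)
    ≡⟨ cong (_+ (x + y)) (shift-distrib-+ (2 + s) (boxed r (2 + s)) (shift 0 (suc r) (boxed (suc r) (suc s))) ξ) ⟩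
  z + shift 0 (2 + s) (shift 0 (suc r) (boxed (suc r) (suc s))) ξ + (x + y)
    ≡⟨ cong (λ u → z + u + (x + y)) exchange ⟩
  z + w + (x + y)
    ≡⟨ rearrange z w x y ⟩
  z + x + (w + y)
    ≡⟨ cong (z + x +_) (shift-distrib-+ (2 + r) (shift 0 (suc s) (boxed (suc r) (suc s))) (boxed (2 + r) s) ξ) ⟨
  boxed (suc r) (2 + s) ξ + shift 0 (2 + r) (boxed (2 + r) (suc s)) ξ ∎
  where
  open ≡-Reasoning
  x = boxed (suc r) (suc s) ξ
  y = shift 0 (2 + r) (boxed (2 + r) s) ξ
  z = shift 0 (2 + s) (boxed r (2 + s)) ξ
  w = shift 0 (2 + r) (shift 0 (suc s) (boxed (suc r) (suc s))) ξ
  regroup : ∀ r s → 2 + s + suc r ≡ 2 + r + suc s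
  regroup = solve-∀
  -- A full row and a full column together form a hook of r + s + 3 cells, whichever of the two is
  -- removed first.
  exchange : shift 0 (2 + s) (shift 0 (suc r) (boxed (suc r) (suc s))) ξ ≡ w
  exchange = begin
    shift 0 (2 + s) (shift 0 (suc r) (boxed (suc r) (suc s))) ξ
      ≡⟨ shift-shift 0 (2 + s) (suc r) (boxed (suc r) (suc s)) ξ ⟩
    shift 0 (2 + s + suc r) (boxed (suc r) (suc s)) ξ
      ≡⟨ cong (λ k → shift 0 k (boxed (suc r) (suc s)) ξ) (regroup r s) ⟩
    shift 0 (2 + r + suc s) (boxed (suc r) (suc s)) ξ
      ≡⟨ shift-shift 0 (2 + r) (suc s) (boxed (suc r) (suc s)) ξ ⟨
    w ∎
  rearrange : ∀ z w x y → z + w + (x + y) ≡ z + x + (w + y)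
  rearrange = solve-∀

+-≡-<⇒> : ∀ {m n k l} → m + n ≡ k + l → m < k → l < n
+-≡-<⇒> eq m<k = ≰⇒> λ n≤l → <⇒≢ (+-mono-<-≤ m<k n≤l) eq

boxed-vanish : ∀ r s {ξ} → r * s < ξ → boxed r s ξ ≡ 0
boxed-vanish zero    s       {suc ξ} _     = refl
boxed-vanish (suc r) zero    {ξ}     rs<ξ  = boxed-vanish r zero rs<ξ
boxed-vanish (suc r) (suc s) {ξ}     rs<ξ  = cong₂ _+_
  (shift-elim (_≡ 0) (suc s) ξ (λ _ → refl)
    (λ η ξ≡ → boxed-vanish r (suc s)
      (+-cancelˡ-< (suc s) (r * suc s) η (<-≤-trans rs<ξ (≤-reflexive ξ≡)))))
  (boxed-vanish (suc r) s (≤-<-trans (*-monoʳ-≤ (suc r) (n≤1+n s)) rs<ξ))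

-- Complementation exchanges "has a full row" with "has no full column". So the row recursion at ξ
-- matches the column recursion at η term by term, and this is what `boxed-dual` is for.
boxed-sym : ∀ r s {ξ η} → ξ + η ≡ r * s → boxed r s ξ ≡ boxed r s η
boxed-sym zero    s    {zero} refl = refl
boxed-sym (suc r) zero {ξ} {η} eq = boxed-sym r zero {ξ} {η} eq
boxed-sym (suc r) (suc s) {ξ} {η} eq = begin
  shift 0 (suc s) (boxed r (suc s)) ξ + boxed (suc r) s ξ
    ≡⟨ cong₂ _+_
        (shift-elim (_≡ boxed r (suc s) η) (suc s) ξ
          (λ ξ<s → sym (boxed-vanish r (suc s) (+-≡-<⇒> eq ξ<s)))
          (λ { ζ refl → boxed-sym r (suc s) (+-cancelˡ-≡ (suc s) _ _
                 (trans (sym (+-assoc (suc s) ζ η)) eq)) }))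
        (shift-elim (boxed (suc r) s ξ ≡_) (suc r) η
          (λ η<r → boxed-vanish (suc r) s (+-≡-<⇒> eq′ η<r))
          (λ { ζ refl → boxed-sym (suc r) s (+-cancelˡ-≡ (suc r) _ _
                 (trans (move (suc r) ξ ζ) eq′)) })) ⟩
  boxed r (suc s) η + shift 0 (suc r) (boxed (suc r) s) η
    ≡⟨ boxed-dual r s η ⟨
  boxed (suc r) (suc s) η ∎
  where
  open ≡-Reasoning
  eq′ : η + ξ ≡ suc r + suc r * s
  eq′ = trans (+-comm η ξ) (trans eq (*-suc (suc r) s))
  move : ∀ k x z → k + (x + z) ≡ k + z + x
  move = solve-∀

-- Lower bounds for the coefficients

boxed-monoˡ : ∀ r s ξ → boxed r s ξ ≤ boxed (suc r) s ξ
boxed-monoˡ r zero    ξ = ≤-refl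
boxed-monoˡ r (suc s) ξ = begin
  boxed r (suc s) ξ                                         ≤⟨ m≤m+n _ _ ⟩
  boxed r (suc s) ξ + shift 0 (suc r) (boxed (suc r) s) ξ   ≡⟨ boxed-dual r s ξ ⟨
  boxed (suc r) (suc s) ξ                                   ∎
  where open ≤-Reasoning

boxed-addPart : ∀ r s ξ → boxed r s ξ ≤ boxed (suc r) s (s + ξ)
boxed-addPart r zero    ξ = ≤-refl
boxed-addPart r (suc s) ξ = begin
  boxed r (suc s) ξ
    ≡⟨ shift-hit 0 (suc s) (boxed r (suc s)) ξ ⟨
  shift 0 (suc s) (boxed r (suc s)) (suc s + ξ)
    ≤⟨ m≤m+n _ _ ⟩
  boxed (suc r) (suc s) (suc s + ξ) ∎
  where open ≤-Reasoning

boxed-one-≤1 : ∀ s ξ → boxed 1 s ξ ≤ 1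
boxed-one-≤1 zero    zero    = ≤-refl
boxed-one-≤1 zero    (suc ξ) = z≤n
boxed-one-≤1 (suc s) ξ rewrite boxed-dual zero s ξ = lemma ξ
  where
  lemma : ∀ ξ → δ ξ + shift 0 1 (boxed 1 s) ξ ≤ 1
  lemma zero    = ≤-refl
  lemma (suc ξ) = boxed-one-≤1 s ξ

boxed-one-≥1 : ∀ s {ξ} → ξ ≤ s → 1 ≤ boxed 1 s ξ
boxed-one-≥1 zero    z≤n = ≤-refl
boxed-one-≥1 (suc s) {ξ} ξ≤s rewrite boxed-dual zero s ξ = lemma ξ≤s
  where
  lemma : ∀ {ξ} → ξ ≤ suc s → 1 ≤ δ ξ + shift 0 1 (boxed 1 s) ξ
  lemma z≤n       = ≤-refl
  lemma (s≤s ξ≤s) = boxed-one-≥1 s ξ≤s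

boxed-zero-≤1 : ∀ r s → boxed r s 0 ≤ 1
boxed-zero-≤1 zero    s       = ≤-refl
boxed-zero-≤1 (suc r) zero    = boxed-zero-≤1 r zero
boxed-zero-≤1 (suc r) (suc s) = boxed-zero-≤1 (suc r) s

-- Two rows suffice: since ξ ≤ s, the smaller part can be any of 0, ..., k. The column recursion
-- splits off the partition with smaller part 0 and strips a column of height two from the others.
boxed-low : ∀ r k s {ξ} → ξ ≤ s → k + k ≤ ξ → k < boxed (2 + r) s ξ
boxed-low zero zero s {ξ} ξ≤s _ =
  ≤-trans (boxed-one-≥1 s ξ≤s) (boxed-monoˡ 1 s ξ)
boxed-low zero (suc k) (suc s) {suc ξ} ξ≤s 2k≤ξ
  rewrite +-suc k k | boxed-dual 1 s (suc ξ) = lemma ξ≤s 2k≤ξ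
  where
  lemma : ∀ {ξ} → suc ξ ≤ suc s → 2 + (k + k) ≤ suc ξ →
    suc (suc k) ≤ boxed 1 (suc s) (suc ξ) + shift 0 2 (boxed 2 s) (suc ξ)
  lemma {suc ξ} ξ≤s (s≤s (s≤s 2k≤ξ)) = +-mono-≤ (boxed-one-≥1 (suc s) ξ≤s)
    (boxed-low zero k s (≤-trans (n≤1+n ξ) (≤-pred ξ≤s)) 2k≤ξ)
boxed-low (suc r) k s {ξ} ξ≤s 2k≤ξ =
  ≤-trans (boxed-low r k s ξ≤s 2k≤ξ) (boxed-monoˡ (2 + r) s ξ)

-- The guard 0 < r matters for K = 2: there k = 1 is needed with s = 3.
boxed-mid : ∀ r k s {ξ} → (0 < r → (k + k) + (k + k) ≤ s) →
            k + k ≤ ξ → ξ + (k + k) ≤ (2 + r) * s → k < boxed (2 + r) s ξ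
boxed-mid zero k s {ξ} _ 2k≤ξ ξ+2k≤2s with ≤-total ξ s
... | inj₁ ξ≤s = boxed-low zero k s ξ≤s 2k≤ξ
-- With two rows the symmetry about s maps the upper half to the lower one, so this case needs no
-- guard on s.
... | inj₂ s≤ξ = subst (k <_) (sym (boxed-sym 2 s {ξ} ξ+η≡2s))
  (boxed-low zero k s η≤s (+-cancelˡ-≤ ξ _ _ (≤-trans ξ+2k≤2s (≤-reflexive (sym ξ+η≡2s)))))
  where
  η = 2 * s ∸ ξ
  ξ+η≡2s : ξ + η ≡ 2 * s
  ξ+η≡2s = m+[n∸m]≡n (≤-trans (m≤m+n ξ _) ξ+2k≤2s)
  η≤s : η ≤ s
  η≤s = begin
    2 * s ∸ ξ  ≤⟨ ∸-monoʳ-≤ (2 * s) s≤ξ ⟩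
    2 * s ∸ s  ≡⟨ m+n∸m≡n s (1 * s) ⟩
    1 * s      ≡⟨ *-identityˡ s ⟩
    s          ∎
    where open ≤-Reasoning
boxed-mid (suc r) k s {ξ} 4k≤s 2k≤ξ ξ+2k≤ with ≤-total (ξ + (k + k)) ((2 + r) * s)
... | inj₁ ξ+2k≤rs = ≤-trans (boxed-mid r k s (λ _ → 4k≤s z<s) 2k≤ξ ξ+2k≤rs)
                             (boxed-monoˡ (2 + r) s ξ)
-- Here a full row is set aside. The remaining size ξ - s must still be at least 2k in the smaller
-- box: ξ ≥ (2 + r)s - 2k ≥ 2s - 2k, and 4k ≤ s turns this into ξ ≥ s + 2k.
... | inj₂ rs≤ξ+2k = subst (λ x → k < boxed (3 + r) s x) (m+[n∸m]≡n s≤ξ)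
  (≤-trans (boxed-mid r k s (λ _ → 4k≤s z<s) 2k≤ζ ζ+2k≤rs) (boxed-addPart (2 + r) s ζ))
  where
  ζ = ξ ∸ s
  s+2k≤ξ : s + (k + k) ≤ ξ
  s+2k≤ξ = +-cancelʳ-≤ (k + k) _ _ (begin
    s + (k + k) + (k + k)     ≡⟨ +-assoc s _ _ ⟩
    s + ((k + k) + (k + k))   ≤⟨ +-monoʳ-≤ s (≤-trans (4k≤s z<s) (m≤m+n s _)) ⟩
    (2 + r) * s               ≤⟨ rs≤ξ+2k ⟩
    ξ + (k + k)               ∎)
    where open ≤-Reasoning
  s≤ξ = ≤-trans (m≤m+n s _) s+2k≤ξ
  2k≤ζ : k + k ≤ ζ
  2k≤ζ = +-cancelˡ-≤ s _ _ (≤-trans s+2k≤ξ (≤-reflexive (sym (m+[n∸m]≡n s≤ξ))))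
  ζ+2k≤rs : ζ + (k + k) ≤ (2 + r) * s
  ζ+2k≤rs = +-cancelˡ-≤ s _ _ (begin
    s + (ζ + (k + k))  ≡⟨ +-assoc s ζ _ ⟨
    s + ζ + (k + k)    ≡⟨ cong (_+ (k + k)) (m+[n∸m]≡n s≤ξ) ⟩
    ξ + (k + k)        ≤⟨ ξ+2k≤ ⟩
    (3 + r) * s        ∎)
    where open ≤-Reasoning

-- Sums over windows of consecutive sizes

sum-≥ : ∀ m n f → (∀ {i} → i < n → m ≤ f i) → n * m ≤ sum (applyUpTo f n)
sum-≥ m zero    f m≤f = z≤n
sum-≥ m (suc n) f m≤f = +-mono-≤ (m≤f z<s) (sum-≥ m n (f ∘ suc) (m≤f ∘ s<s))

sum-cong : ∀ n {f g : ℕ → ℕ} → (∀ {i} → i < n → f i ≡ g i) →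
           sum (applyUpTo f n) ≡ sum (applyUpTo g n)
sum-cong zero    f≡g = refl
sum-cong (suc n) f≡g = cong₂ _+_ (f≡g z<s) (sum-cong n (f≡g ∘ s<s))

sum-zeros : ∀ n {f : ℕ → ℕ} → (∀ i → f i ≡ 0) → sum (applyUpTo f n) ≡ 0
sum-zeros zero    f≡0 = refl
sum-zeros (suc n) f≡0 = cong₂ _+_ (f≡0 0) (sum-zeros n (f≡0 ∘ suc))

-- Serves for complementation, which reverses a window. Relating the indices by `i + suc j ≡ n`
-- keeps truncated subtraction out of the hypothesis.
sum-flip : ∀ n {f g : ℕ → ℕ} → (∀ {i j} → i + suc j ≡ n → f i ≡ g j) →
           sum (applyUpTo f n) ≡ sum (applyUpTo g n)
sum-flip n {f} {g} f≡g = begin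
  sum (applyUpTo f n)            ≡⟨ lemma n f≡g ⟩
  sum (applyDownFrom g n)        ≡⟨ cong sum (reverse-applyUpTo g n) ⟨
  sum (reverse (applyUpTo g n))  ≡⟨ sum-↭ (↭-reverse (applyUpTo g n)) ⟩
  sum (applyUpTo g n)            ∎
  where
  open ≡-Reasoning
  lemma : ∀ n {f : ℕ → ℕ} → (∀ {i j} → i + suc j ≡ n → f i ≡ g j) →
          sum (applyUpTo f n) ≡ sum (applyDownFrom g n)
  lemma zero    f≡g = refl
  lemma (suc n) f≡g = cong₂ _+_ (f≡g refl) (lemma n (f≡g ∘ cong suc))

-- The number of words with r ≥ 1 letters a, s letters b and strip t.
classSize : ℕ → ℕ → ℕ → ℕ
classSize r s t = sum (applyUpTo (λ i → boxed r s (t * r + i)) r)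

classSize-one : ∀ s t → classSize 1 s t ≤ 1
classSize-one s t = ≤-trans (≤-reflexive (+-identityʳ _)) (boxed-one-≤1 s (t * 1 + 0))

-- No partition in the box is larger than rs, so at most the first size of the window is attained,
-- and only for t = s; by symmetry it is attained as often as size 0.
classSize-top : ∀ r s t → s ≤ t → classSize r s t ≤ 1
classSize-top zero    s t s≤t = z≤n
classSize-top (suc r) s t s≤t = begin
  boxed (suc r) s (t * suc r + 0) + sum (applyUpTo (λ i → boxed (suc r) s (t * suc r + suc i)) r)
    ≡⟨ cong₂ _+_ (cong (boxed (suc r) s) (+-identityʳ _))
         (sum-zeros r λ i → boxed-vanish (suc r) s (≤-<-trans rs≤tr (m<m+n _ z<s))) ⟩
  boxed (suc r) s (t * suc r) + 0
    ≡⟨ +-identityʳ _ ⟩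
  boxed (suc r) s (t * suc r)
    ≤⟨ first ⟩
  1 ∎
  where
  open ≤-Reasoning
  rs≤tr : suc r * s ≤ t * suc r
  rs≤tr = ≤-trans (≤-reflexive (*-comm (suc r) s)) (*-monoˡ-≤ (suc r) s≤t)
  first : boxed (suc r) s (t * suc r) ≤ 1
  first with m≤n⇒m<n∨m≡n rs≤tr
  ... | inj₁ rs<tr = ≤-trans (≤-reflexive (boxed-vanish (suc r) s rs<tr)) z≤n
  ... | inj₂ rs≡tr = ≤-trans (≤-reflexive
          (boxed-sym (suc r) s {t * suc r} {0} (trans (+-identityʳ _) (sym rs≡tr))))
          (boxed-zero-≤1 (suc r) s)

-- The last two hypotheses keep the whole window between 2k and (2 + r)s - 2k. Its last size is one
-- less than `suc t * (2 + r)`, whence the `suc` on the right.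
classSize-≥ : ∀ r k s t → (0 < r → (k + k) + (k + k) ≤ s) →
  k + k ≤ t * (2 + r) → suc t * (2 + r) + (k + k) ≤ suc ((2 + r) * s) →
  (2 + r) * suc k ≤ classSize (2 + r) s t
classSize-≥ r k s t 4k≤s 2k≤tr tr+2k≤rs = sum-≥ (suc k) (2 + r) _ λ {i} i<r →
  boxed-mid r k s 4k≤s (≤-trans 2k≤tr (m≤m+n _ i)) (≤-pred (begin
    suc (t * (2 + r) + i + (k + k))     ≡⟨ rearrange (t * (2 + r)) i (k + k) ⟩
    suc i + t * (2 + r) + (k + k)       ≤⟨ +-monoˡ-≤ (k + k) (+-monoˡ-≤ (t * (2 + r)) i<r) ⟩
    suc t * (2 + r) + (k + k)           ≤⟨ tr+2k≤rs ⟩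
    suc ((2 + r) * s)                   ∎))
  where
  open ≤-Reasoning
  rearrange : ∀ x i y → suc (x + i + y) ≡ suc i + x + y
  rearrange = solve-∀

-- Cardinalities from enumerations

unique-length : {xs ys : List A} → Unique xs → Unique ys →
  (∀ {x} → x ∈ xs → x ∈ ys) → (∀ {x} → x ∈ ys → x ∈ xs) → length xs ≡ length ys
unique-length xs! ys! xs⊆ys ys⊆xs =
  ↭-length (∼bag⇒↭ (unique∧set⇒bag xs! ys! (mk⇔ xs⊆ys ys⊆xs)))

lookup-injective : {xs : List A} → Unique xs → ∀ i j → lookup xs i ≡ lookup xs j → i ≡ j
lookup-injective (x∉ ∷ _)   zero    zero    _  = refl
lookup-injective (x∉ ∷ _)   zero    (suc j) eq = contradiction eq (All.lookup x∉ (∈-lookup j))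
lookup-injective (x∉ ∷ _)   (suc i) zero    eq = contradiction (sym eq) (All.lookup x∉ (∈-lookup i))
lookup-injective (_  ∷ xs!) (suc i) (suc j) eq = cong suc (lookup-injective xs! i j eq)

-- The key of an element reveals which list it came from, so distinct lists are disjoint.
unique-concatMap : {f : A → List B} (key : B → A) → (∀ x {y} → y ∈ f x → key y ≡ x) →
  ∀ {xs} → (∀ {x} → x ∈ xs → Unique (f x)) → Unique xs → Unique (concatMap f xs)
unique-concatMap key key≡ f! [] = []
unique-concatMap {f = f} key key≡ {x ∷ xs} f! (x∉ ∷ xs!) =
  Unique.++⁺ (f! (here refl)) (unique-concatMap key key≡ (f! ∘ there) xs!) λ (y∈fx , y∈rest) →
    let z , z∈xs , y∈fz = find (∈-concatMap⁻ f {xs} y∈rest)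
    in All.lookup x∉ z∈xs (trans (sym (key≡ x y∈fx)) (key≡ z y∈fz))

length-concatMap : (f : A → List B) → ∀ xs → length (concatMap f xs) ≡ sum (map (length ∘ f) xs)
length-concatMap f []       = refl
length-concatMap f (x ∷ xs) =
  trans (length-++ (f x)) (cong (length (f x) +_) (length-concatMap f xs))

-- Setoid elements are counted through the values of a complete invariant instead of chosen
-- representatives. For sets the invariant is `id`; for classes of words it is the pair of the
-- number of letters 𝚊 and the strip.
hasCardinality-by : {S : Setoid a ℓ} {P : Setoid.Carrier S → Set p} (key : Setoid.Carrier S → B) →
  let open Setoid S using (_≈_) in
  (∀ {x y} → x ≈ y → key x ≡ key y) → (∀ {x y} → key x ≡ key y → x ≈ y) →
  ∀ {ks} → Unique ks → (∀ {x} → P x → key x ∈ ks) →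
  (∀ {k} → k ∈ ks → ∃ λ x → P x × k ≡ key x) →
  subsetoid S P hasCardinality length ks
hasCardinality-by {S = S} {P = P} key key-cong key-inj {ks} ks! complete sound = record
  { to        = to
  ; from      = from
  ; to-cong   = λ {x} {y} x≈y → to-unique x (trans (key-cong x≈y) (key≡lookup y))
  ; from-cong = λ { refl → Setoid.refl S }
  ; inverse   =
      (λ {i} {x} x≈from → to-unique x (trans (key-cong x≈from) (sym (lookup≡key i)))) ,
      (λ { {x} refl → key-inj (trans (sym (lookup≡key (to x))) (sym (key≡lookup x))) })
  }
  where
  to : ∃ P → Fin (length ks)
  to (_ , px) = index (complete px)
  from : Fin (length ks) → ∃ P
  from i = let x , px , _ = sound (∈-lookup i) in x , px
  key≡lookup : ∀ x → key (proj₁ x) ≡ lookup ks (to x)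
  key≡lookup (_ , px) = lookup-index (complete px)
  lookup≡key : ∀ i → lookup ks i ≡ key (proj₁ (from i))
  lookup≡key i = proj₂ (proj₂ (sound (∈-lookup i)))
  to-unique : ∀ x {i} → key (proj₁ x) ≡ lookup ks i → to x ≡ i
  to-unique x eq = lookup-injective ks! _ _ (trans (sym (key≡lookup x)) eq)

setOf-hasCardinality : {P : A → Set p} {xs : List A} → Unique xs →
  (∀ {x} → P x → x ∈ xs) → (∀ {x} → x ∈ xs → P x) → setOf P hasCardinality length xs
setOf-hasCardinality xs! complete sound =
  hasCardinality-by id id id xs! complete (λ x∈ → _ , sound x∈ , refl)

hasCardinality-unique : {S : Setoid a ℓ} → ∀ {k l} → S hasCardinality k → S hasCardinality l → k ≡ l
hasCardinality-unique S↔k S↔l = ↔⇒≡ (Composition.inverse (Symmetry.inverse S↔k) S↔l)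

∈-shift⁻ : ∀ {x : A} k f ξ → x ∈ shift [] k f ξ → ∃ λ η → ξ ≡ k + η × x ∈ f η
∈-shift⁻ {x = x} k f ξ = shift-elim (λ xs → x ∈ xs → ∃ λ η → ξ ≡ k + η × x ∈ f η) k ξ
  (λ _ ()) (λ η ξ≡ x∈ → η , ξ≡ , x∈)

∈-shift⁺ : ∀ {x : A} k f η → x ∈ f η → x ∈ shift [] k f (k + η)
∈-shift⁺ {x = x} k f η = subst (x ∈_) (sym (shift-hit [] k f η))

unique-shift : ∀ k {f : ℕ → List A} ξ → (∀ η → Unique (f η)) → Unique (shift [] k f ξ)
unique-shift k ξ f! = shift-elim Unique k ξ (λ _ → []) (λ η _ → f! η)

-- The enumeration behind p≤

-- Copies the clauses of `boxed`, so its length is the coefficient by construction. It mediates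
-- between the exhaustive search in `p≤` and the recursion.
boxedPartitions : ℕ → ℕ → ℕ → List (List ℕ)
boxedPartitions zero    s       zero    = [] ∷ []
boxedPartitions zero    s       (suc _) = []
boxedPartitions (suc r) zero    ξ = boxedPartitions r zero ξ
boxedPartitions (suc r) (suc s) ξ =
  map (suc s ∷_) (shift [] (suc s) (boxedPartitions r (suc s)) ξ) ++ boxedPartitions (suc r) s ξ

length-boxedPartitions : ∀ r s ξ → length (boxedPartitions r s ξ) ≡ boxed r s ξ
length-boxedPartitions zero    s       zero    = refl
length-boxedPartitions zero    s       (suc ξ) = refl
length-boxedPartitions (suc r) zero    ξ = length-boxedPartitions r zero ξ
length-boxedPartitions (suc r) (suc s) ξ = begin
  length (map (suc s ∷_) qss ++ boxedPartitions (suc r) s ξ)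
    ≡⟨ length-++ (map (suc s ∷_) qss) ⟩
  length (map (suc s ∷_) qss) + length (boxedPartitions (suc r) s ξ)
    ≡⟨ cong₂ _+_ (length-map (suc s ∷_) qss) (length-boxedPartitions (suc r) s ξ) ⟩
  length qss + boxed (suc r) s ξ
    ≡⟨ cong (_+ boxed (suc r) s ξ) (shift-map length [] (suc s) (boxedPartitions r (suc s)) ξ) ⟩
  shift 0 (suc s) (length ∘ boxedPartitions r (suc s)) ξ + boxed (suc r) s ξ
    ≡⟨ cong (_+ boxed (suc r) s ξ) (shift-cong 0 (suc s) (length-boxedPartitions r (suc s)) ξ) ⟩
  boxed (suc r) (suc s) ξ ∎
  where
  open ≡-Reasoning
  qss = shift [] (suc s) (boxedPartitions r (suc s)) ξ

linked-∷ : ∀ {x qs} → All (_≤ x) qs → Linked _≥_ qs → Linked _≥_ (x ∷ qs)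
linked-∷ []       []         = [-]
linked-∷ (q ∷ _)  [-]        = q ∷ [-]
linked-∷ (q ∷ _)  (q≥ ∷ qs≥) = q ∷ q≥ ∷ qs≥

BoxedPartition : ℕ → ℕ → ℕ → List ℕ → Set
BoxedPartition r s ξ ps = IsPartition ξ ps × length ps ≤ r × All (_≤ s) ps

boxedPartitions-sound : ∀ r s ξ {ps} → ps ∈ boxedPartitions r s ξ → BoxedPartition r s ξ ps
boxedPartitions-sound zero    s    zero (here refl) = ([] , [] , refl) , z≤n , []
boxedPartitions-sound (suc r) zero ξ    ps∈ =
  Product.map₂ (Product.map₁ m≤n⇒m≤1+n) (boxedPartitions-sound r zero ξ ps∈)
boxedPartitions-sound (suc r) (suc s) ξ ps∈
  with ∈-++⁻ (map (suc s ∷_) (shift [] (suc s) (boxedPartitions r (suc s)) ξ)) ps∈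
... | inj₂ ps∈ =
  Product.map₂ (Product.map₂ (All.map m≤n⇒m≤1+n)) (boxedPartitions-sound (suc r) s ξ ps∈)
... | inj₁ ps∈ with ∈-map⁻ (suc s ∷_) ps∈
... | qs , qs∈ , refl with ∈-shift⁻ (suc s) (boxedPartitions r (suc s)) ξ qs∈
... | η , refl , qs∈ with boxedPartitions-sound r (suc s) η qs∈
... | (0<qs , qs≥ , refl) , |qs|≤r , qs≤s =
  (z<s ∷ 0<qs , linked-∷ qs≤s qs≥ , refl) , s≤s |qs|≤r , ≤-refl ∷ qs≤s

boxedPartitions-complete : ∀ r s ξ {ps} → BoxedPartition r s ξ ps → ps ∈ boxedPartitions r s ξ
boxedPartitions-complete zero    s    ξ {[]}     ((_ , _ , refl) , _ , _) = here refl
boxedPartitions-complete (suc r) zero ξ {[]}     (ps⊢ξ , _ , _) =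
  boxedPartitions-complete r zero ξ (ps⊢ξ , z≤n , [])
boxedPartitions-complete (suc r) zero ξ {p ∷ ps} ((0<p ∷ _ , _) , _ , p≤0 ∷ _) =
  contradiction (<-≤-trans 0<p p≤0) λ ()
boxedPartitions-complete (suc r) (suc s) ξ {[]}  (ps⊢ξ , _ , _) =
  ∈-++⁺ʳ (map (suc s ∷_) _) (boxedPartitions-complete (suc r) s ξ (ps⊢ξ , z≤n , []))
boxedPartitions-complete (suc r) (suc s) ξ {p ∷ ps}
  (ps⊢ξ@(_ ∷ 0<ps , ps≥ , refl) , |ps|≤r@(s≤s |ps|≤) , p≤s ∷ ps≤s) with m≤n⇒m<n∨m≡n p≤s
... | inj₁ (s≤s p≤s) = ∈-++⁺ʳ (map (suc s ∷_) _) (boxedPartitions-complete (suc r) s ξ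
        (ps⊢ξ , |ps|≤r , Linked⇒All (flip ≤-trans) p≤s ps≥))
... | inj₂ refl = ∈-++⁺ˡ (∈-map⁺ (suc s ∷_) (∈-shift⁺ (suc s) (boxedPartitions r (suc s)) (sum ps)
        (boxedPartitions-complete r (suc s) (sum ps)
          ((0<ps , Linked.tail ps≥ , refl) , |ps|≤ , ps≤s))))

unique-boxedPartitions : ∀ r s ξ → Unique (boxedPartitions r s ξ)
unique-boxedPartitions zero    s       zero    = [] ∷ []
unique-boxedPartitions zero    s       (suc ξ) = []
unique-boxedPartitions (suc r) zero    ξ = unique-boxedPartitions r zero ξ
unique-boxedPartitions (suc r) (suc s) ξ = Unique.++⁺
  (Unique.map⁺ (proj₂ ∘ ∷-injective) (unique-shift (suc s) ξ (unique-boxedPartitions r (suc s))))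
  (unique-boxedPartitions (suc r) s ξ) disjoint
  where
  disjoint : ∀ {ps qss} → ¬ (ps ∈ map (suc s ∷_) qss × ps ∈ boxedPartitions (suc r) s ξ)
  disjoint (ps∈ , ps∈′) with ∈-map⁻ (suc s ∷_) ps∈
  ... | qs , _ , refl with boxedPartitions-sound (suc r) s ξ ps∈′
  ... | _ , _ , 1+s≤s ∷ _ = <-irrefl refl 1+s≤s

∈-tuples⁻ : ∀ k {xs : List A} {ys} → ys ∈ tuples k xs → length ys ≡ k
∈-tuples⁻ zero    (here refl) = refl
∈-tuples⁻ (suc k) {xs} ys∈ with ∈-cartesianProductWith⁻ _∷_ xs (tuples k xs) ys∈
... | _ , _ , _ , ys∈ , refl = cong suc (∈-tuples⁻ k ys∈)

∈-tuples⁺ : ∀ {xs ys : List A} → All (_∈ xs) ys → ys ∈ tuples (length ys) xs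
∈-tuples⁺ []           = here refl
∈-tuples⁺ (y∈ ∷ ys∈) = ∈-cartesianProductWith⁺ _∷_ y∈ (∈-tuples⁺ ys∈)

unique-tuples : ∀ k {xs : List A} → Unique xs → Unique (tuples k xs)
unique-tuples zero    xs! = [] ∷ []
unique-tuples (suc k) xs! = Unique.cartesianProductWith⁺ _∷_ ∷-injective xs! (unique-tuples k xs!)

parts≤sum : ∀ ps → All (_≤ sum ps) ps
parts≤sum []       = []
parts≤sum (p ∷ ps) = m≤m+n p _ ∷ All.map (λ q≤ → ≤-trans q≤ (m≤n+m _ p)) (parts≤sum ps)

-- Both enumerations are free of repetitions, the tuples of the search being separated by their
-- lengths. That parts are bounded by their sum is used twice: to fit the box in one direction, and
-- to stay in the search range in the other.
p≤≡boxed : ∀ r {s ξ} → ξ ≤ s → p≤ r ξ ≡ boxed r s ξ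
p≤≡boxed r {s} {ξ} ξ≤s = trans
  (unique-length
    (Unique.filter⁺ (isPartition? ξ)
      (unique-concatMap length (λ k → ∈-tuples⁻ k) (λ {k} _ → unique-tuples k (Unique.upTo⁺ (suc ξ)))
        (Unique.upTo⁺ (suc r))))
    (unique-boxedPartitions r s ξ) to from)
  (length-boxedPartitions r s ξ)
  where
  tuplesOf : ℕ → List (List ℕ)
  tuplesOf k = tuples k (upTo (suc ξ))
  to : ∀ {ps} → ps ∈ partitions≤ r ξ → ps ∈ boxedPartitions r s ξ
  to ps∈ with ∈-filter⁻ (isPartition? ξ) {xs = concatMap tuplesOf (upTo (suc r))} ps∈
  ... | ps∈ , ps⊢ξ@(_ , _ , refl) with find (∈-concatMap⁻ tuplesOf {upTo (suc r)} ps∈)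
  ... | k , k∈ , ps∈ = boxedPartitions-complete r s ξ
    ( ps⊢ξ
    , ≤-trans (≤-reflexive (∈-tuples⁻ k ps∈)) (≤-pred (∈-upTo⁻ k∈))
    , All.map (λ q≤ → ≤-trans q≤ ξ≤s) (parts≤sum _))
  from : ∀ {ps} → ps ∈ boxedPartitions r s ξ → ps ∈ partitions≤ r ξ
  from ps∈ with boxedPartitions-sound r s ξ ps∈
  ... | ps⊢ξ@(_ , _ , refl) , |ps|≤r , _ = ∈-filter⁺ (isPartition? ξ)
    (∈-concatMap⁺ tuplesOf (lose (∈-upTo⁺ (s≤s |ps|≤r))
      (∈-tuples⁺ (All.map (∈-upTo⁺ ∘ s≤s) (parts≤sum _)))))
    ps⊢ξ

-- Words as partitions

-- These positions index the occurrences of 𝚊𝚋 that a prepended 𝚊 creates.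
positions𝚋 : Word n → List (Fin n)
positions𝚋 []      = []
positions𝚋 (𝚊 ∷ w) = map suc (positions𝚋 w)
positions𝚋 (𝚋 ∷ w) = zero ∷ map suc (positions𝚋 w)

length-positions𝚋 : (w : Word n) → length (positions𝚋 w) ≡ n ∸ ∣ w ∣ₐ
length-positions𝚋 []      = refl
length-positions𝚋 (𝚊 ∷ w) = trans (length-map suc (positions𝚋 w)) (length-positions𝚋 w)
length-positions𝚋 (𝚋 ∷ w) = trans
  (cong suc (trans (length-map suc (positions𝚋 w)) (length-positions𝚋 w)))
  (sym (+-∸-assoc 1 (Vec.count≤n (𝚊 ≟ᴸ_) w)))

∈-positions𝚋⁻ : (w : Word n) → ∀ {j} → j ∈ positions𝚋 w → Vec.lookup w j ≡ 𝚋
∈-positions𝚋⁻ (𝚊 ∷ w) j∈ with ∈-map⁻ suc j∈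
... | _ , j∈ , refl = ∈-positions𝚋⁻ w j∈
∈-positions𝚋⁻ (𝚋 ∷ w) (here refl) = refl
∈-positions𝚋⁻ (𝚋 ∷ w) (there j∈) with ∈-map⁻ suc j∈
... | _ , j∈ , refl = ∈-positions𝚋⁻ w j∈

∈-positions𝚋⁺ : (w : Word n) → ∀ j → Vec.lookup w j ≡ 𝚋 → j ∈ positions𝚋 w
∈-positions𝚋⁺ (𝚊 ∷ w) (suc j) eq = ∈-map⁺ suc (∈-positions𝚋⁺ w j eq)
∈-positions𝚋⁺ (𝚋 ∷ w) zero    eq = here refl
∈-positions𝚋⁺ (𝚋 ∷ w) (suc j) eq = there (∈-map⁺ suc (∈-positions𝚋⁺ w j eq))

unique-positions𝚋 : (w : Word n) → Unique (positions𝚋 w)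
unique-positions𝚋 []      = []
unique-positions𝚋 (𝚊 ∷ w) = Unique.map⁺ Fin.suc-injective (unique-positions𝚋 w)
unique-positions𝚋 (𝚋 ∷ w) =
  All.tabulate (λ j∈ → λ { refl → contradiction (∈-map⁻ suc j∈) λ () })
  ∷ Unique.map⁺ Fin.suc-injective (unique-positions𝚋 w)

occurrences : Word n → List (Fin n × Fin n)
occurrences {n} w = filter (occursAt? w) (cartesianProduct (allFin n) (allFin n))

∈-occurrences⁻ : (w : Word n) → ∀ {ij} → ij ∈ occurrences w → OccursAt w ij
∈-occurrences⁻ {n} w ij∈ =
  proj₂ (∈-filter⁻ (occursAt? w) {xs = cartesianProduct (allFin n) (allFin n)} ij∈)

∈-occurrences⁺ : (w : Word n) → ∀ {ij} → OccursAt w ij → ij ∈ occurrences w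
∈-occurrences⁺ w = ∈-filter⁺ (occursAt? w) (∈-cartesianProduct⁺ (∈-allFin _) (∈-allFin _))

unique-occurrences : (w : Word n) → Unique (occurrences w)
unique-occurrences {n} w = Unique.filter⁺ (occursAt? w)
  (Unique.cartesianProduct⁺ (Unique.allFin⁺ n) (Unique.allFin⁺ n))

suc² : Fin n × Fin n → Fin (suc n) × Fin (suc n)
suc² (i , j) = suc i , suc j

suc²-injective : {ij kl : Fin n × Fin n} → suc² ij ≡ suc² kl → ij ≡ kl
suc²-injective refl = refl

∈-occurrences-∷⁺ : ∀ x (w : Word n) {ij} → ij ∈ occurrences w → suc² ij ∈ occurrences (x ∷ w)
∈-occurrences-∷⁺ x w ij∈ =
  ∈-occurrences⁺ (x ∷ w) (Product.map₁ s<s (∈-occurrences⁻ w ij∈))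

binom-ab-𝚋 : (w : Word n) → binom-ab (𝚋 ∷ w) ≡ binom-ab w
binom-ab-𝚋 w = trans
  (unique-length (unique-occurrences (𝚋 ∷ w)) (Unique.map⁺ suc²-injective (unique-occurrences w))
    to from)
  (length-map suc² (occurrences w))
  where
  to : ∀ {ij} → ij ∈ occurrences (𝚋 ∷ w) → ij ∈ map suc² (occurrences w)
  to {i , j} ij∈ with i | j | ∈-occurrences⁻ (𝚋 ∷ w) ij∈
  ... | suc i | suc j | i<j , occ = ∈-map⁺ suc² (∈-occurrences⁺ w (≤-pred i<j , occ))
  ... | zero  | _     | _ , () , _
  ... | suc i | zero  | () , _
  from : ∀ {ij} → ij ∈ map suc² (occurrences w) → ij ∈ occurrences (𝚋 ∷ w)
  from ij∈ with ∈-map⁻ suc² ij∈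
  ... | _ , ij∈ , refl = ∈-occurrences-∷⁺ 𝚋 w ij∈

-- The new 𝚊 pairs with each 𝚋 of `w`. In terms of partitions it is a part of full width.
binom-ab-𝚊 : (w : Word n) → binom-ab (𝚊 ∷ w) ≡ (n ∸ ∣ w ∣ₐ) + binom-ab w
binom-ab-𝚊 {n} w = begin
  length (occurrences (𝚊 ∷ w))
    ≡⟨ unique-length (unique-occurrences (𝚊 ∷ w)) new! to from ⟩
  length (map first (positions𝚋 w) ++ map suc² (occurrences w))
    ≡⟨ length-++ (map first (positions𝚋 w)) ⟩
  length (map first (positions𝚋 w)) + length (map suc² (occurrences w))
    ≡⟨ cong₂ _+_ (length-map first (positions𝚋 w)) (length-map suc² (occurrences w)) ⟩
  length (positions𝚋 w) + binom-ab w
    ≡⟨ cong (_+ binom-ab w) (length-positions𝚋 w) ⟩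
  (n ∸ ∣ w ∣ₐ) + binom-ab w ∎
  where
  open ≡-Reasoning
  first : Fin n → Fin (suc n) × Fin (suc n)
  first j = zero , suc j
  new! : Unique (map first (positions𝚋 w) ++ map suc² (occurrences w))
  new! = Unique.++⁺ (Unique.map⁺ (λ { refl → refl }) (unique-positions𝚋 w))
    (Unique.map⁺ suc²-injective (unique-occurrences w)) disjoint
    where
    disjoint : ∀ {ij} → ¬ (ij ∈ map first (positions𝚋 w) × ij ∈ map suc² (occurrences w))
    disjoint (ij∈ , ij∈′) with ∈-map⁻ first ij∈
    ... | _ , _ , refl with ∈-map⁻ suc² ij∈′
    ... | _ , _ , ()
  to : ∀ {ij} → ij ∈ occurrences (𝚊 ∷ w) →
       ij ∈ map first (positions𝚋 w) ++ map suc² (occurrences w)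
  to {i , j} ij∈ with i | j | ∈-occurrences⁻ (𝚊 ∷ w) ij∈
  ... | zero  | suc j | _ , _ , eq = ∈-++⁺ˡ (∈-map⁺ first (∈-positions𝚋⁺ w j eq))
  ... | suc i | suc j | i<j , occ  =
    ∈-++⁺ʳ (map first (positions𝚋 w)) (∈-map⁺ suc² (∈-occurrences⁺ w (≤-pred i<j , occ)))
  ... | zero  | zero  | () , _
  ... | suc i | zero  | () , _
  from : ∀ {ij} → ij ∈ map first (positions𝚋 w) ++ map suc² (occurrences w) →
         ij ∈ occurrences (𝚊 ∷ w)
  from ij∈ with ∈-++⁻ (map first (positions𝚋 w)) ij∈
  ... | inj₁ ij∈ with ∈-map⁻ first ij∈
  ...   | _ , j∈ , refl = ∈-occurrences⁺ (𝚊 ∷ w) (z<s , refl , ∈-positions𝚋⁻ w j∈)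
  from _ | inj₂ ij∈ with ∈-map⁻ suc² ij∈
  ...   | _ , ij∈ , refl = ∈-occurrences-∷⁺ 𝚊 w ij∈

-- The recursion of `boxed` once more: a leading 𝚊 is a full row, as long as the number `n ∸ r` of
-- letters 𝚋, and a leading 𝚋 narrows the box by one column. When the subtraction truncates,
-- `words n r` is empty anyway.
words : ∀ n → ℕ → ℕ → List (Word n)
words zero    zero    zero    = [] ∷ []
words zero    zero    (suc _) = []
words zero    (suc _) _       = []
words (suc n) zero    ξ = map (𝚋 ∷_) (words n zero ξ)
words (suc n) (suc r) ξ =
  map (𝚊 ∷_) (shift [] (n ∸ r) (words n r) ξ) ++ map (𝚋 ∷_) (words n (suc r) ξ)

words-sound : ∀ n r ξ {w} → w ∈ words n r ξ → ∣ w ∣ₐ ≡ r × binom-ab w ≡ ξ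
words-sound zero zero zero (here refl) = refl , refl
words-sound (suc n) zero ξ w∈ with ∈-map⁻ (𝚋 ∷_) w∈
... | w , w∈ , refl = Product.map₂ (trans (binom-ab-𝚋 w)) (words-sound n zero ξ w∈)
words-sound (suc n) (suc r) ξ w∈ with ∈-++⁻ (map (𝚊 ∷_) (shift [] (n ∸ r) (words n r) ξ)) w∈
... | inj₂ w∈ with ∈-map⁻ (𝚋 ∷_) w∈
...   | w , w∈ , refl = Product.map₂ (trans (binom-ab-𝚋 w)) (words-sound n (suc r) ξ w∈)
words-sound (suc n) (suc r) ξ _ | inj₁ w∈ with ∈-map⁻ (𝚊 ∷_) w∈
... | w , w∈ , refl with ∈-shift⁻ (n ∸ r) (words n r) ξ w∈
... | η , refl , w∈ with words-sound n r η w∈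
... | refl , refl = refl , binom-ab-𝚊 w

∈-words-𝚋 : ∀ r {ξ} {w : Word n} → w ∈ words n r ξ → 𝚋 ∷ w ∈ words (suc n) r ξ
∈-words-𝚋 zero    w∈ = ∈-map⁺ (𝚋 ∷_) w∈
∈-words-𝚋 (suc r) w∈ = ∈-++⁺ʳ (map (𝚊 ∷_) _) (∈-map⁺ (𝚋 ∷_) w∈)

words-complete : (w : Word n) → w ∈ words n ∣ w ∣ₐ (binom-ab w)
words-complete [] = here refl
words-complete {suc n} (𝚊 ∷ w) rewrite binom-ab-𝚊 w =
  ∈-++⁺ˡ (∈-map⁺ (𝚊 ∷_) (∈-shift⁺ (n ∸ ∣ w ∣ₐ) (words n ∣ w ∣ₐ) (binom-ab w) (words-complete w)))
words-complete (𝚋 ∷ w) rewrite binom-ab-𝚋 w = ∈-words-𝚋 ∣ w ∣ₐ (words-complete w)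

unique-words : ∀ n r ξ → Unique (words n r ξ)
unique-words zero    zero    zero    = [] ∷ []
unique-words zero    zero    (suc _) = []
unique-words zero    (suc r) ξ       = []
unique-words (suc n) zero    ξ = Unique.map⁺ Vec.∷-injectiveʳ (unique-words n zero ξ)
unique-words (suc n) (suc r) ξ = Unique.++⁺
  (Unique.map⁺ Vec.∷-injectiveʳ (unique-shift (n ∸ r) ξ (unique-words n r)))
  (Unique.map⁺ Vec.∷-injectiveʳ (unique-words n (suc r) ξ)) disjoint
  where
  disjoint : ∀ {w : Word (suc n)} {us vs} → ¬ (w ∈ map (𝚊 ∷_) us × w ∈ map (𝚋 ∷_) vs)
  disjoint (w∈ , w∈′) with ∈-map⁻ (𝚊 ∷_) w∈
  ... | _ , _ , refl with ∈-map⁻ (𝚋 ∷_) w∈′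
  ... | _ , _ , ()

words-empty : ∀ {n r} ξ → n < r → words n r ξ ≡ []
words-empty {zero}  {suc r} ξ n<r = refl
words-empty {suc n} {suc r} ξ (s≤s n<r) rewrite words-empty {n} {suc r} ξ (m<n⇒m<1+n n<r) =
  shift-elim (λ us → map (𝚊 ∷_) us ++ [] ≡ []) (n ∸ r) ξ (λ _ → refl)
    (λ η _ → cong (λ us → map (𝚊 ∷_) us ++ []) (words-empty η n<r))

length-words : ∀ {n} r s → n ≡ r + s → ∀ ξ → length (words n r ξ) ≡ boxed r s ξ
length-words {zero}  zero zero    refl zero    = refl
length-words {zero}  zero zero    refl (suc ξ) = refl
length-words {suc n} zero (suc s) refl ξ =
  trans (length-map (𝚋 ∷_) (words n zero ξ)) (length-words {n} zero n refl ξ)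
length-words {suc n} (suc r) s eq ξ = begin
  length (map (𝚊 ∷_) us ++ map (𝚋 ∷_) vs)
    ≡⟨ length-++ (map (𝚊 ∷_) us) ⟩
  length (map (𝚊 ∷_) us) + length (map (𝚋 ∷_) vs)
    ≡⟨ cong₂ _+_ (length-map (𝚊 ∷_) us) (length-map (𝚋 ∷_) vs) ⟩
  length us + length vs
    ≡⟨ cong (_+ length vs) (shift-map length [] (n ∸ r) (words n r) ξ) ⟩
  shift 0 (n ∸ r) (length ∘ words n r) ξ + length vs
    ≡⟨ cong (_+ length vs) (shift-cong 0 (n ∸ r) (length-words r s n≡r+s) ξ) ⟩
  shift 0 (n ∸ r) (boxed r s) ξ + length vs
    ≡⟨ cong (λ k → shift 0 k (boxed r s) ξ + length vs)
         (trans (cong (_∸ r) n≡r+s) (m+n∸m≡n r s)) ⟩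
  shift 0 s (boxed r s) ξ + length vs
    ≡⟨ last s n≡r+s ⟩
  boxed (suc r) s ξ ∎
  where
  open ≡-Reasoning
  us = shift [] (n ∸ r) (words n r) ξ
  vs = words n (suc r) ξ
  n≡r+s : n ≡ r + s
  n≡r+s = suc-injective eq
  last : ∀ s → n ≡ r + s → shift 0 s (boxed r s) ξ + length vs ≡ boxed (suc r) s ξ
  -- With no 𝚋 available the second branch is empty, in agreement with the clause of `boxed` for
  -- width zero, which has a single summand.
  last zero    n≡r+0 = trans
    (cong (λ us → boxed r zero ξ + length us)
      (words-empty ξ (s≤s (≤-reflexive (trans n≡r+0 (+-identityʳ r))))))
    (+-identityʳ _)
  last (suc s) n≡r+1+s = cong (shift 0 (suc s) (boxed r (suc s)) ξ +_)
    (length-words (suc r) s (trans n≡r+1+s (+-suc r s)) ξ)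

-- For r = 0 the window is empty, although the word without 𝚊 has strip 0. Hence the positivity
-- hypotheses below, and the separate treatment of that word in `class-of-no-𝚊`.
wordsWithStrip : ∀ n → ℕ → ℕ → List (Word n)
wordsWithStrip n r t = concatMap (words n r) (applyUpTo (t * r +_) r)

unique-wordsWithStrip : ∀ n r t → Unique (wordsWithStrip n r t)
unique-wordsWithStrip n r t = unique-concatMap binom-ab
  (λ ξ w∈ → proj₂ (words-sound n r ξ w∈)) (λ {ξ} _ → unique-words n r ξ)
  (Unique.applyUpTo⁺₁ (t * r +_) r λ i<j _ → <⇒≢ i<j ∘ +-cancelˡ-≡ (t * r) _ _)

length-wordsWithStrip : ∀ {n} r s t → n ≡ r + s → length (wordsWithStrip n r t) ≡ classSize r s t
length-wordsWithStrip {n} r s t n≡r+s = begin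
  length (wordsWithStrip n r t)
    ≡⟨ length-concatMap (words n r) (applyUpTo (t * r +_) r) ⟩
  sum (map (length ∘ words n r) (applyUpTo (t * r +_) r))
    ≡⟨ cong sum (map-applyUpTo (t * r +_) (length ∘ words n r) r) ⟩
  sum (applyUpTo (λ i → length (words n r (t * r + i))) r)
    ≡⟨ sum-cong r (λ {i} _ → length-words r s n≡r+s (t * r + i)) ⟩
  classSize r s t ∎
  where open ≡-Reasoning

wordsWithStrip-sound : ∀ n r t {w} → w ∈ wordsWithStrip n r t → ∣ w ∣ₐ ≡ r × strip w ≡ t
wordsWithStrip-sound n (suc r) t {w} w∈
  with find (∈-concatMap⁻ (words n (suc r)) {applyUpTo (t * suc r +_) (suc r)} w∈)
... | ξ , ξ∈ , w∈ with ∈-applyUpTo⁻ (t * suc r +_) ξ∈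
... | i , i<r , refl with words-sound n (suc r) (t * suc r + i) w∈
... | |w|≡r , ab≡ξ = |w|≡r , (begin
  floorDiv (binom-ab w) ∣ w ∣ₐ    ≡⟨ cong₂ floorDiv ab≡ξ |w|≡r ⟩
  (t * suc r + i) / suc r         ≡⟨ +-distrib-/-∣ˡ i (n∣m*n t) ⟩
  t * suc r / suc r + i / suc r   ≡⟨ cong₂ _+_ (m*n/n≡m t (suc r)) (m<n⇒m/n≡0 i<r) ⟩
  t + 0                           ≡⟨ +-identityʳ t ⟩
  t                               ∎)
  where open ≡-Reasoning

wordsWithStrip-complete : (w : Word n) → 0 < ∣ w ∣ₐ → w ∈ wordsWithStrip n ∣ w ∣ₐ (strip w)
wordsWithStrip-complete {n} w 0<|w| with ∣ w ∣ₐ in eq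
... | suc r = ∈-concatMap⁺ (words n (suc r)) (lose
    (∈-applyUpTo⁺ (t * suc r +_) (m%n<n ξ (suc r)))
    (subst₂ (λ r ξ → w ∈ words n r ξ) eq
      (trans (m≡m%n+[m/n]*n ξ (suc r)) (+-comm (ξ % suc r) _)) (words-complete w)))
  where
  ξ = binom-ab w
  t = ξ / suc r

class-hasCardinality : (w : Word n) → 0 < ∣ w ∣ₐ →
  class w hasCardinality length (wordsWithStrip n ∣ w ∣ₐ (strip w))
class-hasCardinality {n} w 0<|w| = setOf-hasCardinality
  (unique-wordsWithStrip n ∣ w ∣ₐ (strip w)) complete (wordsWithStrip-sound n ∣ w ∣ₐ (strip w))
  where
  complete : ∀ {u} → u ∼ w → u ∈ wordsWithStrip n ∣ w ∣ₐ (strip w)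
  complete {u} (|u|≡|w| , strip≡) = subst₂ (λ r t → u ∈ wordsWithStrip n r t) |u|≡|w| strip≡
    (wordsWithStrip-complete u (<-≤-trans 0<|w| (≤-reflexive (sym |u|≡|w|))))

no-𝚊-unique : (u w : Word n) → ∣ u ∣ₐ ≡ 0 → ∣ w ∣ₐ ≡ 0 → u ≡ w
no-𝚊-unique []      []      _  _  = refl
no-𝚊-unique (𝚋 ∷ u) (𝚋 ∷ w) |u|≡0 |w|≡0 = cong (𝚋 ∷_) (no-𝚊-unique u w |u|≡0 |w|≡0)

class-of-no-𝚊 : ∀ {K} (w : Word n) → ∣ w ∣ₐ ≡ 0 → class w hasCardinality K → K ≤ 1
class-of-no-𝚊 w |w|≡0 S↔K = ≤-reflexive (hasCardinality-unique S↔K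
  (setOf-hasCardinality {xs = w ∷ []} ([] ∷ [])
    (λ {u} (|u|≡|w| , _) → here (no-𝚊-unique u w (trans |u|≡|w| |w|≡0) |w|≡0))
    (λ { (here refl) → refl , refl })))

-- Classes of size K

sumFromTo≡ : ∀ lo hi {k} f → suc hi ∸ lo ≡ k →
  sumFromTo lo hi f ≡ sum (applyUpTo (λ i → f (lo + i)) k)
sumFromTo≡ lo hi f refl = cong sum (map-applyUpTo (lo +_) f (suc hi ∸ lo))

L≡ : ∀ r α → L (suc r) α ≡ sum (applyUpTo (λ i → p≤ (suc r) (α * suc r + i)) (suc r))
L≡ r α = sumFromTo≡ (α * suc r) ((α + 1) * suc r ∸ 1) (p≤ (suc r)) (begin
  suc ((α + 1) * suc r ∸ 1) ∸ α * suc r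
    -- Once `α + 1` has become `1 + α`, the product computes to a successor and `∸ 1` cancels.
    ≡⟨ cong (λ β → suc (β * suc r ∸ 1) ∸ α * suc r) (+-comm α 1) ⟩
  suc r + α * suc r ∸ α * suc r
    ≡⟨ m+n∸n≡m (suc r) (α * suc r) ⟩
  suc r ∎)
  where open ≡-Reasoning

R≡ : ∀ r b → R (suc r) (suc b) ≡ sum (applyUpTo (λ i → p≤ (suc r) (b * suc r + 1 + i)) (suc r))
R≡ r b = sumFromTo≡ (b * suc r + 1) (suc b * suc r) (p≤ (suc r)) (begin
  suc (suc r + b * suc r) ∸ (b * suc r + 1)
    ≡⟨ cong (suc (suc r + b * suc r) ∸_) (+-comm (b * suc r) 1) ⟩
  suc r + b * suc r ∸ b * suc r
    ≡⟨ m+n∸n≡m (suc r) (b * suc r) ⟩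
  suc r ∎)
  where open ≡-Reasoning

-- The last size in the window is one less than `suc α * suc r`, so the hypothesis says exactly that
-- all sizes are at most `s`.
L≡classSize : ∀ r s α → suc α * suc r ≤ suc s → L (suc r) α ≡ classSize (suc r) s α
L≡classSize r s α αr≤s = trans (L≡ r α) (sum-cong (suc r) λ {i} i<r →
  p≤≡boxed (suc r) (≤-pred (begin
    suc (α * suc r + i)   ≡⟨ +-suc (α * suc r) i ⟨
    α * suc r + suc i     ≤⟨ +-monoʳ-≤ (α * suc r) i<r ⟩
    α * suc r + suc r     ≡⟨ +-comm (α * suc r) (suc r) ⟩
    suc α * suc r         ≤⟨ αr≤s ⟩
    suc s                 ∎)))
  where open ≤-Reasoning

-- Write m for `suc r` and β for `suc b`. In a box of width β + t, complementation sends the size tm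
-- + j to βm - j. As j runs from 0 to m - 1 this gives (β - 1)m + 1, ..., βm in reverse order, which
-- explains the offset by one against the window of `L`.
R≡classSize : ∀ r b t → suc b * suc r ≤ suc b + t →
  R (suc r) (suc b) ≡ classSize (suc r) (suc b + t) t
R≡classSize r b t βr≤s = trans (R≡ r b) (sum-flip (suc r) λ {i} {j} i+j≡r → trans
  (p≤≡boxed (suc r) (begin
    b * suc r + 1 + i     ≡⟨ +-assoc (b * suc r) 1 i ⟩
    b * suc r + suc i     ≤⟨ +-monoʳ-≤ (b * suc r) (m+n≤o⇒m≤o (suc i) (≤-reflexive (trans (sym (+-suc i j)) i+j≡r))) ⟩
    b * suc r + suc r     ≡⟨ +-comm (b * suc r) (suc r) ⟩
    suc b * suc r         ≤⟨ βr≤s ⟩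
    suc b + t             ∎))
  (boxed-sym (suc r) (suc b + t) (trans (regroup b (suc r) i t j)
    (trans (cong (λ k → b * suc r + t * suc r + k) i+j≡r) (distribute b (suc r) t)))))
  where
  open ≤-Reasoning
  regroup : ∀ b r i t j → b * r + 1 + i + (t * r + j) ≡ b * r + t * r + (i + suc j)
  regroup = solve-∀
  distribute : ∀ b r t → b * r + t * r + r ≡ r * (suc b + t)
  distribute = solve-∀

-- Partitions into at most two parts are already enough, because 2k ≤ k(2 + r) ≤ ξ.
p≤-≥ : ∀ r k ξ → k * (2 + r) ≤ ξ → suc k ≤ p≤ (2 + r) ξ
p≤-≥ r k ξ kr≤ξ = subst (suc k ≤_) (sym (p≤≡boxed (2 + r) {ξ} ≤-refl))
  (boxed-low r k ξ ≤-refl (begin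
    k + k        ≡⟨ double k ⟩
    k * 2        ≤⟨ *-monoʳ-≤ k (m≤m+n 2 r) ⟩
    k * (2 + r)  ≤⟨ kr≤ξ ⟩
    ξ            ∎))
  where
  open ≤-Reasoning
  double : ∀ k → k + k ≡ k * 2
  double = solve-∀

L-≥ : ∀ r α → (2 + r) * suc α ≤ L (2 + r) α
L-≥ r α = subst ((2 + r) * suc α ≤_) (sym (L≡ (suc r) α))
  (sum-≥ (suc α) (2 + r) _ λ {i} _ → p≤-≥ r α (α * (2 + r) + i) (m≤m+n _ i))

R-≥ : ∀ r b → (2 + r) * suc b ≤ R (2 + r) (suc b)
R-≥ r b = subst ((2 + r) * suc b ≤_) (sym (R≡ (suc r) b))
  (sum-≥ (suc b) (2 + r) _ λ {i} _ →
    p≤-≥ r b (b * (2 + r) + 1 + i) (≤-trans (m≤m+n _ 1) (m≤m+n _ i)))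

-- The two bounds on k = ⌊K/2⌋ pull in opposite directions: 2k ≤ K keeps the ends of the box short,
-- and K < 2(k + 1) makes two coefficients above k sum to more than K.
half : ∀ K → ∃ λ k → k + k ≤ K × K < suc k + suc k
half zero          = 0 , z≤n , z<s
half (suc zero)    = 0 , z≤n , s<s z<s
half (suc (suc K)) with k , lower , upper ← half K =
  suc k , subst (_≤ 2 + K) (cong suc (sym (+-suc k k))) (s≤s (s≤s lower))
        , subst (2 + K <_) (cong suc (sym (+-suc (suc k) (suc k)))) (s<s (s<s upper))

K+K≤K*K : ∀ {K} → 2 ≤ K → K + K ≤ K * K
K+K≤K*K {K} 2≤K = begin
  K + K   ≡⟨ cong (K +_) (+-identityʳ K) ⟨
  2 * K   ≤⟨ *-monoˡ-≤ K 2≤K ⟩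
  K * K   ∎
  where open ≤-Reasoning

module _ {K s : ℕ} (2≤K : 2 ≤ K) (K²≤1+s : K * K ≤ suc s) where

  K+K≤1+s : K + K ≤ suc s
  K+K≤1+s = ≤-trans (K+K≤K*K 2≤K) K²≤1+s

  K≤s : K ≤ s
  K≤s = ≤-pred (≤-trans (+-monoˡ-≤ K (≤-trans (s≤s z≤n) 2≤K)) K+K≤1+s)

  -- A window that starts before 2k satisfies (t + 1)r ≤ r + 2k ≤ 2K, with r standing for the number
  -- of rows; one that ends beyond rs - 2k satisfies (s - t)r + 2 ≤ r + 2k ≤ 2K. Since 2K ≤ s + 1,
  -- these are the hypotheses of `L≡classSize` and `R≡classSize`.
  near-end : ∀ r t → t < s → 2 + r ≤ K → classSize (2 + r) s t ≡ K →
             suc t * (2 + r) ≤ suc s ⊎ (s ∸ t) * (2 + r) ≤ s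
  near-end r t t<s r≤K size≡K
    with k , 2k≤K , K<2k+2 ← half K
    with k + k ≤? t * (2 + r) | suc t * (2 + r) + (k + k) ≤? suc ((2 + r) * s)
  ... | yes 2k≤tr | yes tr+2k≤rs = contradiction (begin-strict
    K                        <⟨ K<2k+2 ⟩
    suc k + suc k            ≡⟨ cong (suc k +_) (+-identityʳ (suc k)) ⟨
    2 * suc k                ≤⟨ *-monoˡ-≤ (suc k) (m≤m+n 2 r) ⟩
    (2 + r) * suc k          ≤⟨ classSize-≥ r k s t 4k≤s 2k≤tr tr+2k≤rs ⟩
    classSize (2 + r) s t    ≡⟨ size≡K ⟩
    K                        ∎) (<-irrefl refl)
    where
    open ≤-Reasoning
    -- At least three rows force K ≥ 3, so 4k + 1 ≤ 2K + 1 ≤ 3K ≤ K² ≤ s + 1.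
    4k≤s : 0 < r → (k + k) + (k + k) ≤ s
    4k≤s 0<r = ≤-pred (begin
      suc ((k + k) + (k + k))  ≤⟨ s≤s (+-mono-≤ 2k≤K 2k≤K) ⟩
      suc (K + K)              ≤⟨ +-monoˡ-≤ (K + K) (≤-trans (s≤s z≤n) 2≤K) ⟩
      K + (K + K)              ≡⟨ cong (λ x → K + (K + x)) (+-identityʳ K) ⟨
      3 * K                    ≤⟨ *-monoˡ-≤ K (≤-trans (s≤s (s≤s 0<r)) r≤K) ⟩
      K * K                    ≤⟨ K²≤1+s ⟩
      suc s                    ∎)
  ... | no 2k≰tr | _ = inj₁ (≤-trans
    (+-mono-≤ r≤K (≤-trans (<⇒≤ (≰⇒> 2k≰tr)) 2k≤K)) K+K≤1+s)
  ... | yes _ | no tr+2k≰rs = inj₂ (≤-pred (≤-trans (≤-trans (n≤1+n _) 2+βr≤2K) K+K≤1+s))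
    where
    open ≤-Reasoning
    expand : ∀ r t β → t * r + (2 + β * r) ≡ suc (suc (r * (t + β)))
    expand = solve-∀
    regroup : ∀ r x k → r + x + k ≡ x + (r + k)
    regroup = solve-∀
    2+βr≤2K : 2 + (s ∸ t) * (2 + r) ≤ K + K
    2+βr≤2K = +-cancelˡ-≤ (t * (2 + r)) _ _ (begin
      t * (2 + r) + (2 + (s ∸ t) * (2 + r))   ≡⟨ expand (2 + r) t (s ∸ t) ⟩
      suc (suc ((2 + r) * (t + (s ∸ t))))     ≡⟨ cong (λ x → suc (suc ((2 + r) * x))) (m+[n∸m]≡n (<⇒≤ t<s)) ⟩
      suc (suc ((2 + r) * s))                 ≤⟨ ≰⇒> tr+2k≰rs ⟩
      suc t * (2 + r) + (k + k)               ≡⟨ regroup (2 + r) (t * (2 + r)) (k + k) ⟩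
      t * (2 + r) + (2 + r + (k + k))         ≤⟨ +-monoʳ-≤ (t * (2 + r)) (+-mono-≤ r≤K 2k≤K) ⟩
      t * (2 + r) + (K + K)                   ∎)

  L⇒classSize : ∀ r α → L (2 + r) α ≡ K → classSize (2 + r) s α ≡ K
  L⇒classSize r α Lα≡K = trans (sym (L≡classSize (suc r) s α (begin
    suc α * (2 + r)   ≡⟨ *-comm (suc α) (2 + r) ⟩
    (2 + r) * suc α   ≤⟨ L-≥ r α ⟩
    L (2 + r) α       ≡⟨ Lα≡K ⟩
    K                 ≤⟨ m≤n⇒m≤1+n K≤s ⟩
    suc s             ∎))) Lα≡K
    where open ≤-Reasoning

  R⇒classSize : ∀ r b → R (2 + r) (suc b) ≡ K →
                suc b ≤ s × classSize (2 + r) s (s ∸ suc b) ≡ K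
  R⇒classSize r b Rβ≡K = β≤s , subst (λ x → classSize (2 + r) x (s ∸ suc b) ≡ K) β+t≡s
    (trans (sym (R≡classSize (suc r) b (s ∸ suc b) (≤-trans βr≤s (≤-reflexive (sym β+t≡s))))) Rβ≡K)
    where
    open ≤-Reasoning
    βr≤s : suc b * (2 + r) ≤ s
    βr≤s = begin
      suc b * (2 + r)     ≡⟨ *-comm (suc b) (2 + r) ⟩
      (2 + r) * suc b     ≤⟨ R-≥ r b ⟩
      R (2 + r) (suc b)   ≡⟨ Rβ≡K ⟩
      K                   ≤⟨ K≤s ⟩
      s                   ∎
    β≤s : suc b ≤ s
    β≤s = ≤-trans (m≤m*n (suc b) (2 + r)) βr≤s
    β+t≡s : suc b + (s ∸ suc b) ≡ s
    β+t≡s = m+[n∸m]≡n β≤s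

  -- A strip counted from both ends would have α + β = s. Adding the bounds `L-≥` and `R-≥` then
  -- gives 2K ≥ (2 + r)(s + 1) ≥ 2(s + 1), whereas 2K ≤ s + 1.
  ends-disjoint : ∀ r b → L (2 + r) (s ∸ suc b) ≡ K → R (2 + r) (suc b) ≢ K
  ends-disjoint r b Lα≡K Rβ≡K = contradiction (begin-strict
    K + K                          ≤⟨ K+K≤1+s ⟩
    suc s                          <⟨ m<m+n (suc s) z<s ⟩
    suc s + suc s                  ≡⟨ cong (suc s +_) (+-identityʳ (suc s)) ⟨
    2 * suc s                      ≤⟨ *-monoˡ-≤ (suc s) (m≤m+n 2 r) ⟩
    (2 + r) * suc s                ≡⟨ cong (λ x → (2 + r) * suc x) (m∸n+n≡m β≤s) ⟨
    (2 + r) * (suc α + suc b)      ≡⟨ *-distribˡ-+ (2 + r) (suc α) (suc b) ⟩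
    (2 + r) * suc α + (2 + r) * suc b
      ≤⟨ +-mono-≤ (≤-trans (L-≥ r α) (≤-reflexive Lα≡K)) (≤-trans (R-≥ r b) (≤-reflexive Rβ≡K)) ⟩
    K + K                          ∎) (<-irrefl refl)
    where
    open ≤-Reasoning
    α = s ∸ suc b
    β≤s = proj₁ (R⇒classSize r b Rβ≡K)

classify : ∀ {K n} r s t → 2 ≤ K → K * K + K ≤ suc n → n ≡ r + s → classSize r s t ≡ K →
  2 ≤ r × r ≤ K × (L r t ≡ K ⊎ (∃ λ b → R r (suc b) ≡ K × t ≡ s ∸ suc b))
classify zero          s t 2≤K _ _ refl = contradiction 2≤K λ ()
classify (suc zero)    s t 2≤K _ _ refl = contradiction (≤-trans 2≤K (classSize-one s t)) (<-irrefl refl)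
classify {K} {n} (suc (suc r)) s t 2≤K K²+K≤1+n n≡r+s size≡K =
  s≤s (s≤s z≤n) , r≤K , result (near-end 2≤K K²≤1+s r t t<s r≤K size≡K)
  where
  open ≤-Reasoning
  t<s : t < s
  t<s = ≰⇒> λ s≤t → <⇒≱ 2≤K (≤-trans (≤-reflexive (sym size≡K)) (classSize-top (2 + r) s t s≤t))
  r≤K : 2 + r ≤ K
  r≤K = begin
    2 + r                    ≡⟨ *-identityʳ (2 + r) ⟨
    -- The case k = 0 says that every size from 0 to (2 + r)s is attained, so each of the 2 + r
    -- sizes in the window contributes a word. It makes no demand on s, about which nothing is known
    -- before r is bounded.
    (2 + r) * 1              ≤⟨ classSize-≥ r 0 s t (λ _ → z≤n) z≤n (begin
        suc t * (2 + r) + 0    ≡⟨ +-identityʳ _ ⟩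
        suc t * (2 + r)        ≤⟨ *-monoˡ-≤ (2 + r) t<s ⟩
        s * (2 + r)            ≡⟨ *-comm s (2 + r) ⟩
        (2 + r) * s            ≤⟨ n≤1+n _ ⟩
        suc ((2 + r) * s)      ∎) ⟩
    classSize (2 + r) s t    ≡⟨ size≡K ⟩
    K                        ∎
  K²≤1+s : K * K ≤ suc s
  K²≤1+s = +-cancelʳ-≤ K _ _ (begin
    K * K + K        ≤⟨ K²+K≤1+n ⟩
    suc n            ≡⟨ cong suc (trans n≡r+s (+-comm (2 + r) s)) ⟩
    suc s + (2 + r)  ≤⟨ +-monoʳ-≤ (suc s) r≤K ⟩
    suc s + K        ∎)
  result : suc t * (2 + r) ≤ suc s ⊎ (s ∸ t) * (2 + r) ≤ s →
    L (2 + r) t ≡ K ⊎ (∃ λ b → R (2 + r) (suc b) ≡ K × t ≡ s ∸ suc b)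
  result (inj₁ tr≤s) = inj₁ (trans (L≡classSize (suc r) s t tr≤s) size≡K)
  result (inj₂ βr≤s) with s ∸ t in eq
  ... | zero  = contradiction eq (m>n⇒m∸n≢0 t<s)
  ... | suc b = inj₂ (b , trans (R≡classSize (suc r) b t (≤-trans βr≤s (≤-reflexive (sym β+t≡s))))
                        (trans (cong (λ x → classSize (2 + r) x t) β+t≡s) size≡K)
                    , sym (trans (cong (s ∸_) (sym eq)) (m∸[m∸n]≡n (<⇒≤ t<s))))
    where
    β+t≡s : suc b + t ≡ s
    β+t≡s = trans (cong (_+ t) (sym eq)) (m∸n+n≡m (<⇒≤ t<s))

-- Enumeration of the classes by number of letters 𝚊 and strip

module _ (K : ℕ) where

  -- For r ≥ 2 the bounds `L-≥` and `R-≥` yield α < K and 1 ≤ β ≤ K for all solutions, so these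
  -- finite searches find them all.
  leftEnds rightEnds : ℕ → List ℕ
  leftEnds  r = filter (λ α → L r α ≟ K) (upTo K)
  rightEnds r = filter (λ β → R r β ≟ K) (applyUpTo suc K)

  ∈-leftEnds⁺ : ∀ {r α} → 2 ≤ r → L r α ≡ K → α ∈ leftEnds r
  ∈-leftEnds⁺ {suc (suc r)} {α} (s≤s (s≤s _)) Lα≡K = ∈-filter⁺ (λ α → L (2 + r) α ≟ K)
    (∈-upTo⁺ (≤-trans (m≤n*m (suc α) (2 + r)) (≤-trans (L-≥ r α) (≤-reflexive Lα≡K)))) Lα≡K

  ∈-leftEnds⁻ : ∀ r {α} → α ∈ leftEnds r → L r α ≡ K
  ∈-leftEnds⁻ r = proj₂ ∘ ∈-filter⁻ (λ α → L r α ≟ K) {xs = upTo K}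

  ∈-rightEnds⁺ : ∀ {r b} → 2 ≤ r → R r (suc b) ≡ K → suc b ∈ rightEnds r
  ∈-rightEnds⁺ {suc (suc r)} {b} (s≤s (s≤s _)) Rβ≡K = ∈-filter⁺ (λ β → R (2 + r) β ≟ K)
    (∈-applyUpTo⁺ suc (≤-trans (m≤n*m (suc b) (2 + r)) (≤-trans (R-≥ r b) (≤-reflexive Rβ≡K)))) Rβ≡K

  ∈-rightEnds⁻ : ∀ r {β} → β ∈ rightEnds r → ∃ λ b → β ≡ suc b × R r (suc b) ≡ K
  ∈-rightEnds⁻ r β∈ with ∈-filter⁻ (λ β → R r β ≟ K) {xs = applyUpTo suc K} β∈
  ... | β∈ , Rβ≡K with ∈-applyUpTo⁻ suc β∈
  ... | b , _ , refl = b , refl , Rβ≡K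

  unique-leftEnds : ∀ r → Unique (leftEnds r)
  unique-leftEnds r = Unique.filter⁺ _ (Unique.upTo⁺ K)

  unique-rightEnds : ∀ r → Unique (rightEnds r)
  unique-rightEnds r = Unique.filter⁺ _
    (Unique.applyUpTo⁺₁ suc K λ i<j _ → <⇒≢ i<j ∘ suc-injective)

  strips : ℕ → ℕ → List ℕ
  strips r s = leftEnds r ++ map (s ∸_) (rightEnds r)

  unique-strips : ∀ {s} → 2 ≤ K → K * K ≤ suc s → ∀ {r} → 2 ≤ r → Unique (strips r s)
  unique-strips {s} 2≤K K²≤1+s {suc (suc r)} (s≤s (s≤s _)) =
    Unique.++⁺ (unique-leftEnds (2 + r)) (Unique.map⁻ {f = s ∸_} flipped!) disjoint
    where
    -- Truncated subtraction from `s` is not injective, but on solutions β ≤ s it is undone by a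
    -- second application. The doubly reflected list is therefore `rightEnds` itself, and
    -- `Unique.map⁻` carries its uniqueness back to the list reflected once.
    flipped! : Unique (map (s ∸_) (map (s ∸_) (rightEnds (2 + r))))
    flipped! = subst Unique
      (trans (sym (map-id-local (All.tabulate λ β∈ → twice (∈-rightEnds⁻ (2 + r) β∈))))
        (map-∘ (rightEnds (2 + r))))
      (unique-rightEnds (2 + r))
      where
      twice : ∀ {β} → (∃ λ b → β ≡ suc b × R (2 + r) (suc b) ≡ K) → s ∸ (s ∸ β) ≡ β
      twice (b , refl , Rβ≡K) = m∸[m∸n]≡n (proj₁ (R⇒classSize 2≤K K²≤1+s r b Rβ≡K))
    disjoint : ∀ {t} → ¬ (t ∈ leftEnds (2 + r) × t ∈ map (s ∸_) (rightEnds (2 + r)))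
    disjoint (t∈ , t∈′) with ∈-map⁻ (s ∸_) t∈′
    ... | β , β∈ , refl with ∈-rightEnds⁻ (2 + r) β∈
    ... | b , refl , Rβ≡K = ends-disjoint 2≤K K²≤1+s r b (∈-leftEnds⁻ (2 + r) t∈) Rβ≡K

  ∈-strips⁻ : ∀ {s} → 2 ≤ K → K * K ≤ suc s → ∀ {r t} → 2 ≤ r → t ∈ strips r s → classSize r s t ≡ K
  ∈-strips⁻ {s} 2≤K K²≤1+s {suc (suc r)} {t} (s≤s (s≤s _)) t∈ with ∈-++⁻ (leftEnds (2 + r)) t∈
  ... | inj₁ t∈ = L⇒classSize 2≤K K²≤1+s r t (∈-leftEnds⁻ (2 + r) t∈)
  ... | inj₂ t∈ with ∈-map⁻ (s ∸_) t∈
  ... | β , β∈ , refl with ∈-rightEnds⁻ (2 + r) β∈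
  ... | b , refl , Rβ≡K = proj₂ (R⇒classSize 2≤K K²≤1+s r b Rβ≡K)

  -- Definitionally the index list of a sum over 2 ⋯ K, as `suc K ∸ 2` reduces to `K ∸ 1`.
  rows : List ℕ
  rows = applyUpTo (2 +_) (K ∸ 1)

  keysInRow : ℕ → ℕ → List (ℕ × ℕ)
  keysInRow n r = map (r ,_) (strips r (n ∸ r))

  keys : ℕ → List (ℕ × ℕ)
  keys n = concatMap (keysInRow n) rows

  length-keysInRow : ∀ n r → length (keysInRow n r) ≡ length (leftEnds r) + length (rightEnds r)
  length-keysInRow n r = begin
    length (keysInRow n r)
      ≡⟨ length-map (r ,_) (strips r (n ∸ r)) ⟩
    length (strips r (n ∸ r))
      ≡⟨ length-++ (leftEnds r) ⟩
    length (leftEnds r) + length (map (n ∸ r ∸_) (rightEnds r))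
      ≡⟨ cong (length (leftEnds r) +_) (length-map (n ∸ r ∸_) (rightEnds r)) ⟩
    length (leftEnds r) + length (rightEnds r) ∎
    where open ≡-Reasoning

  module _ {n : ℕ} (2≤K : 2 ≤ K) (K²+K≤1+n : K * K + K ≤ suc n) where

    ∈-rows⁺ : ∀ {r} → 2 ≤ r → r ≤ K → r ∈ rows
    ∈-rows⁺ (s≤s (s≤s {n = i} _)) r≤K = ∈-applyUpTo⁺ (2 +_) {i} (m+n≤o⇒m≤o∸n (suc i)
      (≤-trans (≤-reflexive (+-comm (suc i) 1)) r≤K))

    ∈-rows⁻ : ∀ {r} → r ∈ rows → 2 ≤ r × r ≤ K
    ∈-rows⁻ r∈ with ∈-applyUpTo⁻ (2 +_) r∈
    ... | i , i<K-1 , refl = s≤s (s≤s z≤n) ,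
      ≤-trans (s≤s i<K-1) (≤-reflexive (m+[n∸m]≡n (≤-trans (s≤s z≤n) 2≤K)))

    K²≤1+n∸r : ∀ {r} → r ≤ K → K * K ≤ suc (n ∸ r)
    K²≤1+n∸r {r} r≤K = begin
      K * K           ≡⟨ m+n∸n≡m (K * K) K ⟨
      K * K + K ∸ K   ≤⟨ ∸-mono K²+K≤1+n r≤K ⟩
      suc n ∸ r       ≤⟨ 1+n∸r≤ ⟩
      suc (n ∸ r)     ∎
      where
      open ≤-Reasoning
      1+n∸r≤ : suc n ∸ r ≤ suc (n ∸ r)
      1+n∸r≤ = m≤n+o⇒m∸n≤o (suc n) r (≤-trans (s≤s (m≤n+m∸n n r)) (≤-reflexive (sym (+-suc r (n ∸ r)))))

    r≤n : ∀ {r} → r ≤ K → r ≤ n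
    r≤n r≤K = ≤-pred (begin
      suc _       ≤⟨ s≤s r≤K ⟩
      suc K       ≤⟨ +-monoˡ-≤ K (≤-trans (≤-trans (s≤s z≤n) (m≤n⇒m≤n+o K 2≤K)) (K+K≤K*K 2≤K)) ⟩
      K * K + K   ≤⟨ K²+K≤1+n ⟩
      suc n       ∎)
      where open ≤-Reasoning

    key : Word n → ℕ × ℕ
    key w = ∣ w ∣ₐ , strip w

    keys-complete : (w : Word n) → class w hasCardinality K → key w ∈ keys n
    keys-complete w S↔K with n≢0⇒n>0 {∣ w ∣ₐ} (λ |w|≡0 → <⇒≱ 2≤K (class-of-no-𝚊 w |w|≡0 S↔K))
    ... | 0<|w| with classify ∣ w ∣ₐ (n ∸ ∣ w ∣ₐ) (strip w) 2≤K K²+K≤1+n n≡r+s (trans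
          (sym (length-wordsWithStrip ∣ w ∣ₐ (n ∸ ∣ w ∣ₐ) (strip w) n≡r+s))
          (hasCardinality-unique {S = class w} (class-hasCardinality w 0<|w|) S↔K))
      where
      n≡r+s : n ≡ ∣ w ∣ₐ + (n ∸ ∣ w ∣ₐ)
      n≡r+s = sym (m+[n∸m]≡n (Vec.count≤n (𝚊 ≟ᴸ_) w))
    ... | 2≤r , r≤K , end = ∈-concatMap⁺ (keysInRow n) (lose (∈-rows⁺ 2≤r r≤K)
          (∈-map⁺ (∣ w ∣ₐ ,_) (strip∈ end)))
      where
      strip∈ : L ∣ w ∣ₐ (strip w) ≡ K ⊎
               (∃ λ b → R ∣ w ∣ₐ (suc b) ≡ K × strip w ≡ n ∸ ∣ w ∣ₐ ∸ suc b) →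
               strip w ∈ strips ∣ w ∣ₐ (n ∸ ∣ w ∣ₐ)
      strip∈ (inj₁ Lt≡K) = ∈-++⁺ˡ (∈-leftEnds⁺ 2≤r Lt≡K)
      strip∈ (inj₂ (b , Rβ≡K , t≡)) = ∈-++⁺ʳ (leftEnds ∣ w ∣ₐ)
        (subst (_∈ map (n ∸ ∣ w ∣ₐ ∸_) (rightEnds ∣ w ∣ₐ)) (sym t≡)
          (∈-map⁺ (n ∸ ∣ w ∣ₐ ∸_) (∈-rightEnds⁺ 2≤r Rβ≡K)))

    keys-sound : ∀ {rt} → rt ∈ keys n →
            ∃ λ (w : Word n) → class w hasCardinality K × rt ≡ key w
    keys-sound rt∈ with find (∈-concatMap⁻ (keysInRow n) {rows} rt∈)
    ... | r , r∈ , rt∈ with ∈-map⁻ (r ,_) rt∈ | ∈-rows⁻ r∈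
    ... | t , t∈ , refl | 2≤r , r≤K = witness (wordsWithStrip n r t) refl
          (trans (length-wordsWithStrip r (n ∸ r) t (sym (m+[n∸m]≡n (r≤n r≤K))))
            (∈-strips⁻ 2≤K (K²≤1+n∸r r≤K) 2≤r t∈))
      where
      -- The list has K ≥ 2 entries, so its first word exists and represents the class. Matching on
      -- a separate `ws` leaves the length equation for the original list intact.
      witness : ∀ ws → wordsWithStrip n r t ≡ ws → length (wordsWithStrip n r t) ≡ K →
                ∃ λ (w : Word n) → class w hasCardinality K × (r , t) ≡ key w
      witness [] eq |ws|≡K =
        contradiction (subst (2 ≤_) (trans (sym |ws|≡K) (cong length eq)) 2≤K) λ ()
      witness (w ∷ _) eq |ws|≡K
        with wordsWithStrip-sound n r t {w} (subst (w ∈_) (sym eq) (here refl))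
      ... | refl , refl = w ,
        subst (class w hasCardinality_) |ws|≡K (class-hasCardinality w (≤-trans (s≤s z≤n) 2≤r)) , refl

    classes-hasCardinality : classesOfSize K n hasCardinality length (keys n)
    classes-hasCardinality = hasCardinality-by {S = wordSetoid n} key
      (λ (p , q) → cong₂ _,_ p q) ,-injective
      (unique-concatMap proj₁ first≡ keysInRow!
        (Unique.applyUpTo⁺₁ (2 +_) (K ∸ 1) λ i<j _ → <⇒≢ i<j ∘ +-cancelˡ-≡ 2 _ _))
      (λ {w} → keys-complete w) keys-sound
      where
      first≡ : ∀ r {rt} → rt ∈ keysInRow n r → proj₁ rt ≡ r
      first≡ r rt∈ with ∈-map⁻ (r ,_) rt∈
      ... | _ , _ , refl = refl
      keysInRow! : ∀ {r} → r ∈ rows → Unique (keysInRow n r)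
      keysInRow! r∈ with ∈-rows⁻ r∈
      ... | 2≤r , r≤K = Unique.map⁺ ,-injectiveʳ (unique-strips 2≤K (K²≤1+n∸r r≤K) 2≤r)

theorem5 : (K n : ℕ) → K ≥ 2 → n ≥ K ^ 2 + K ∸ 1 →
    Σ[ N ∈ ℕ ] Σ[ #L ∈ (ℕ → ℕ) ] Σ[ #R ∈ (ℕ → ℕ) ]
    (classesOfSize K n hasCardinality N)
    × (∀ r → 2 ≤ r → r ≤ K →
    (setOf (λ α → L r α ≡ K) hasCardinality #L r)
    × (setOf (λ β → 0 < β × R r β ≡ K) hasCardinality #R r))
    × N ≡ ∑[ r ∈ 2 ⋯ K ] (#L r + #R r)
theorem5 K n 2≤K n≥ =
  length (keys K n) ,
  length ∘ leftEnds K , length ∘ rightEnds K ,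
  classes-hasCardinality K 2≤K K²+K≤1+n ,
  (λ r 2≤r _ →
    setOf-hasCardinality (unique-leftEnds K r) (∈-leftEnds⁺ K 2≤r) (∈-leftEnds⁻ K r) ,
    setOf-hasCardinality (unique-rightEnds K r)
      (λ { {suc b} (_ , Rβ≡K) → ∈-rightEnds⁺ K 2≤r Rβ≡K }) (rightSound r)) ,
  trans (length-concatMap (keysInRow K n) (rows K))
    (cong sum (map-cong (length-keysInRow K n) (rows K)))
  where
  K²+K≤1+n : K * K + K ≤ suc n
  -- `K ^ 2` unfolds to `K * (K * 1)`, from which the trailing factor is removed.
  K²+K≤1+n = subst (λ x → K * x + K ≤ suc n) (*-identityʳ K)
    (≤-trans (m≤n+m∸n (K ^ 2 + K) 1) (s≤s n≥))
  rightSound : ∀ r {β} → β ∈ rightEnds K r → 0 < β × R r β ≡ K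
  rightSound r β∈ with ∈-rightEnds⁻ K r β∈
  ... | b , refl , Rβ≡K = z<s , Rβ≡K
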